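{- Let $n \geq 2$ and $0 \leq k \leq n/2$ be integers, and let $\mathcal{B}_{n,k}$ be the set of positive $k$-roots with no defects. Then: (i) The labelling function $\lambda : \mathcal{B}_{n,k} \to \Lambda_{n,k}$ is a bijection. (ii) The set $\mathcal{B}_{n,k}$ is a basis for $V_{n,k}$ over $\mathbb{Q}$. (iii) Every positive $k$-root is a linear combination of elements of $\mathcal{B}_{n,k}$ with nonnegative integer coefficients. (iv) The elements of $\mathcal{B}_{n,k}$ are the only positive $k$-roots that cannot be written as positive linear combinations of other positive $k$-roots.
   Context: $V_{n,k}$ is the $\mathbb{Q}$-vector space with basis the set of squarefree monomials $x_I=\prod_{i\in I}x_i$ of degree $k$ in commuting indeterminates $x_1,\dots,x_n$ ($I\subseteq\{1,\dots,n\}$, $|I|=k$). Order these monomials lexicographically: for distinct $I,J$, let $t$ be the smallest element of the symmetric difference $I\,\Delta\,J$; then $x_I \prec x_J$ if $t\in I$. A nonzero $v\in V_{n,k}$ is positive ($v>0$) if the $\prec$-minimal monomial appearing in $v$ has positive coefficient, negative otherwise. A $k$-root is an element of $V_{n,k}$ of the form $\prod_{r=1}^k(\pm x_{i_{2r-1}}\pm x_{i_{2r}})$, with signs chosen independently and $i_1,\dots,i_{2k}$ distinct indices in $\{1,\dots,n\}$; it is positive if it is $>0$. Every positive $k$-root can be written as $\prod_{r=1}^k(x_{i_{2r-1}}\pm x_{i_{2r}})$ with $i_{2r-1}<i_{2r}$ for all $r$, uniquely up to reordering the factors (its normal form). In the normal form, a factor $(x_i-x_j)$ ($i<j$) is antisymmetric,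 a factor $(x_i+x_j)$ is symmetric, and an index not appearing in any factor is unused. A positive $k$-root has a defect if its normal form has one of the following, where $i<j<r<s$: (i) two factors $(x_i\pm x_r)$ and $(x_j\pm x_s)$; (ii) a factor $(x_i\pm x_s)$ and a symmetric factor $(x_j+x_r)$; (iii) a factor $(x_i\pm x_r)$ and an unused index $j$; (iv) a symmetric factor $(x_i+x_j)$ and an unused index $r$. For $\alpha\in\mathcal{B}_{n,k}$, its label $\lambda(\alpha)$ is the word of length $n$ over $\{1,2\}$ with $\lambda(\alpha)_j=2$ iff the normal form of $\alpha$ has a factor $(x_i-x_j)$ for some $i<j$. $\Lambda_{n,k}$ is the set of lattice words of length $n$ over $\{1,2\}$ (every initial segment contains at least as many 1s as 2s) with at most $k$ occurrences of $2$. -}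

module Defs where

open import Data.Nat as ℕ using (ℕ; zero; suc)
open import Data.Integer using (+_)
open import Data.Fin as Fin using (Fin)
open import Data.Fin.Subset using (Subset; ∣_∣; _∈_; _∉_; ⁅_⁆; _∪_; ⊥)
open import Data.Bool.Properties renaming (_≟_ to _≟B_)
open import Data.Vec as Vec using (Vec; lookup; toList)
open import Data.Vec.Properties using (≡-dec)
open import Data.List as List using (List; []; _∷_; take)
open import Data.List.Relation.Unary.All using (All)
open import Data.List.Relation.Unary.AllPairs using (AllPairs)
open import Data.List.Relation.Unary.Unique.Propositional using (Unique)
open import Data.List.Membership.Propositional as LM using ()
open import Data.Rational as ℚ using (ℚ; 0ℚ; 1ℚ; _/_)
open import Data.Product using (Σ; _×_; _,_; proj₁; proj₂)
open import Relation.Nullary using (¬_; yes; no)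
open import Relation.Binary.PropositionalEquality using (_≡_)

-- The space V_{n,k}: coefficient functions on k-element subsets of
-- {0,…,n-1} (the squarefree monomials x_I of degree k).

KSet : ℕ → ℕ → Set
KSet n k = Σ (Subset n) (λ I → ∣ I ∣ ≡ k)

V : ℕ → ℕ → Set
V n k = KSet n k → ℚ

_≈V_ : ∀ {n k} → V n k → V n k → Set
u ≈V v = ∀ I → u I ≡ v I

zeroV : ∀ {n k} → V n k
zeroV I = 0ℚ

lincomb : ∀ {n k} → List (ℚ × V n k) → V n k
lincomb [] I = 0ℚ
lincomb ((c , v) ∷ xs) I = c ℚ.* v I ℚ.+ lincomb xs I

ℕtoℚ : ℕ → ℚ
ℕtoℚ c = (+ c) / 1

_≺_ : ∀ {n} → Subset n → Subset n → Set
_≺_ {n} I J = Σ (Fin n) λ t → t ∈ I × t ∉ J ×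
  (∀ s → s Fin.< t → (s ∈ I → s ∈ J) × (s ∈ J → s ∈ I))

Positive : ∀ {n k} → V n k → Set
Positive {n} {k} v = Σ (KSet n k) λ I → (0ℚ ℚ.< v I) ×
  (∀ J → proj₁ J ≺ proj₁ I → v J ≡ 0ℚ)

data Sgn : Set where
  plus minus : Sgn

sgnQ : Sgn → ℚ
sgnQ plus = 1ℚ
sgnQ minus = ℚ.- 1ℚ

-- a factor (s , a , t , b) stands for  (s x_a + t x_b)
Factor : ℕ → Set
Factor n = Sgn × Fin n × Sgn × Fin n

indices : ∀ {n} → List (Factor n) → List (Fin n)
indices [] = []
indices ((s , a , t , b) ∷ fs) = a ∷ b ∷ indices fs

-- expansion of a product of linear factors into a list of terms
-- (coefficient , set of variables of the monomial)
terms : ∀ {n} → List (Factor n) → List (ℚ × Subset n)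
terms [] = (1ℚ , ⊥) ∷ []
terms ((s , a , t , b) ∷ fs) = go (terms fs)
  where
  go : _ → _
  go [] = []
  go ((c , S) ∷ ts) = (sgnQ s ℚ.* c , ⁅ a ⁆ ∪ S) ∷ (sgnQ t ℚ.* c , ⁅ b ⁆ ∪ S) ∷ go ts

coeffAt : ∀ {n} → Subset n → List (ℚ × Subset n) → ℚ
coeffAt I [] = 0ℚ
coeffAt I ((c , S) ∷ ts) with ≡-dec _≟B_ S I
... | yes _ = c ℚ.+ coeffAt I ts
... | no _ = coeffAt I ts

poly : ∀ {n k} → Vec (Factor n) k → V n k
poly fs I = coeffAt (proj₁ I) (terms (toList fs))

RootExpr : ℕ → ℕ → Set
RootExpr n k = Σ (Vec (Factor n) k) λ fs → Unique (indices (toList fs))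

IsKRoot : ∀ {n k} → V n k → Set
IsKRoot {n} {k} α = Σ (RootExpr n k) λ e → poly (proj₁ e) ≈V α

PosRoot : ∀ {n k} → V n k → Set
PosRoot α = IsKRoot α × Positive α

NormalFactor : ∀ {n} → Factor n → Set
NormalFactor (s , a , t , b) = s ≡ plus × a Fin.< b

NF : ℕ → ℕ → Set
NF n k = Σ (RootExpr n k) λ e → All NormalFactor (toList (proj₁ e))

facs : ∀ {n k} → NF n k → List (Factor n)
facs f = toList (proj₁ (proj₁ f))

IsNormalFormOf : ∀ {n k} → NF n k → V n k → Set
IsNormalFormOf f α = poly (proj₁ (proj₁ f)) ≈V α

_∈F_ : ∀ {n} → Factor n → List (Factor n) → Set
x ∈F F = x LM.∈ F

Unused : ∀ {n} → Fin n → List (Factor n) → Set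
Unused j F = ¬ (j LM.∈ indices F)

data Defect {n k : ℕ} (f : NF n k) : Set where
  defect-i : ∀ i j r s t t' → i Fin.< j → j Fin.< r → r Fin.< s →
    (plus , i , t , r) ∈F facs f → (plus , j , t' , s) ∈F facs f → Defect f
  defect-ii : ∀ i j r s t → i Fin.< j → j Fin.< r → r Fin.< s →
    (plus , i , t , s) ∈F facs f → (plus , j , plus , r) ∈F facs f → Defect f
  defect-iii : ∀ i j r t → i Fin.< j → j Fin.< r →
    (plus , i , t , r) ∈F facs f → Unused j (facs f) → Defect f
  defect-iv : ∀ i j r → i Fin.< j → j Fin.< r →
    (plus , i , plus , j) ∈F facs f → Unused r (facs f) → Defect f

HasDefect : ∀ {n k} → V n k → Set
HasDefect {n} {k} α = Σ (NF n k) λ f → IsNormalFormOf f α × Defect f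

InB : ∀ {n k} → V n k → Set
InB α = PosRoot α × ¬ HasDefect α

data Letter : Set where
  one two : Letter

count : Letter → List Letter → ℕ
count x [] = 0
count one (one ∷ ws) = suc (count one ws)
count one (two ∷ ws) = count one ws
count two (one ∷ ws) = count two ws
count two (two ∷ ws) = suc (count two ws)

Lattice : List Letter → Set
Lattice ws = ∀ m → count two (take m ws) ℕ.≤ count one (take m ws)

InΛ : ∀ {n} → ℕ → Vec Letter n → Set
InΛ k w = Lattice (toList w) × count two (toList w) ℕ.≤ k

HasLabel : ∀ {n k} → V n k → Vec Letter n → Set
HasLabel {n} {k} α w = Σ (NF n k) λ f → IsNormalFormOf f α ×
  (∀ j → (lookup w j ≡ two → Σ (Fin n) λ i → (plus , i , minus , j) ∈F facs f)
       × (Σ (Fin n) (λ i → (plus , i , minus , j) ∈F facs f) → lookup w j ≡ two))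

Spans : ∀ {n k} → (V n k → Set) → Set
Spans {n} {k} P = ∀ (v : V n k) → Σ (List (ℚ × V n k)) λ L →
  All (λ cv → P (proj₂ cv)) L × lincomb L ≈V v

LinIndep : ∀ {n k} → (V n k → Set) → Set
LinIndep {n} {k} P = ∀ (L : List (ℚ × V n k)) →
  All (λ cv → P (proj₂ cv)) L →
  AllPairs (λ x y → ¬ (proj₂ x ≈V proj₂ y)) L →
  lincomb L ≈V zeroV → All (λ cv → proj₁ cv ≡ 0ℚ) L

IsBasis : ∀ {n k} → (V n k → Set) → Set
IsBasis P = Spans P × LinIndep P

LabelBijection : ℕ → ℕ → Set
LabelBijection n k =
  (∀ (α : V n k) → InB α → Σ (Vec Letter n) λ w → HasLabel α w × InΛ k w)
  × (∀ (α : V n k) w w' → InB α → HasLabel α w → HasLabel α w' → w ≡ w')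
  × (∀ (α β : V n k) w → InB α → InB β → HasLabel α w → HasLabel β w → α ≈V β)
  × (∀ (w : Vec Letter n) → InΛ k w → Σ (V n k) λ α → InB α × HasLabel α w)

NonnegIntCombOfB : ∀ {n k} → V n k → Set
NonnegIntCombOfB {n} {k} α = Σ (List (ℕ × V n k)) λ L →
  All (λ cv → InB (proj₂ cv)) L ×
  lincomb (List.map (λ cv → ℕtoℚ (proj₁ cv) , proj₂ cv) L) ≈V α

PosCombOfOthers : ∀ {n k} → V n k → Set
PosCombOfOthers {n} {k} α = Σ (List (ℚ × V n k)) λ L →
  All (λ cv → (0ℚ ℚ.< proj₁ cv) × PosRoot (proj₂ cv) × ¬ (proj₂ cv ≈V α)) L ×
  lincomb L ≈V α

{-# OPTIONS --safe #-}
-- A product F of linear factors is studied through its values ev p F at integer points p; the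
-- coefficient of x_I in a k-root is its value at the indicator of I.
--
-- Each defect comes with an identity writing the k-root as a sum of at least two other positive
-- k-roots.  At the point p_i = n − i (i counted from 0) every positive k-root has a positive
-- integer value, and these values add up, so resolving defects terminates: every positive k-root
-- is a sum of defect-free ones.  Every x_I is a combination of k-roots because
-- x_a = ((x_a + x_b) + (x_a − x_b)) / 2.
--
-- For a word w let p_j be the letter w_j.  There α does not vanish if λ(α) = w, whereas α vanishes
-- if w precedes λ(α) lexicographically, because then some factor x_i − x_d of α has w_i = w_d = 1.
-- This triangularity makes k-roots with distinct labels independent.  A defect-free k-root is
-- determined by its label: a 2 is matched with the nearest free 1 as in a bracketing, and the
-- symmetric factors join the last unmatched indices consecutively.  So if a defect-free k-root is a
-- positive combination of positive k-roots, resolving the latter yields only copies of it; having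
-- a coefficient 1 it occurs once in each, which rules out other k-roots and defects.
module Submission where

open import Defs
open import Data.Nat as ℕ using (ℕ; zero; suc; z≤n; s≤s; _≤_; _*_)
import Data.Nat.Properties as ℕP
import Data.Nat.Induction as ℕI
open import Data.Integer as ℤ using (ℤ; +_; 0ℤ; 1ℤ)
import Data.Integer.Properties as ℤP
import Data.Integer.Tactic.RingSolver as ℤR
open import Data.Rational as ℚ using (ℚ; 0ℚ; 1ℚ; ½; _/_)
import Data.Rational.Properties as ℚP
open import Data.Rational.Solver using (module +-*-Solver)
open import Data.Nat.Coprimality using (Coprime; 1-coprimeTo) renaming (sym to coprime-sym)
open import Data.Bool using (Bool; true; false; if_then_else_)
open import Data.Bool.Properties using () renaming (_≟_ to _≟B_)
open import Data.Fin as Fin using (Fin; zero; suc; toℕ)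
import Data.Fin.Properties as FinP
open import Data.Fin.Subset using (Subset; ∣_∣; _∈_; _∉_; ⁅_⁆; _∪_; ⊥)
import Data.Fin.Subset.Properties as SubP
open import Data.Vec as Vec using (Vec; []; _∷_; here; there; lookup; toList; tabulate)
import Data.Vec.Properties as VecP
open import Data.List as List using (List; []; _∷_; _++_; length; take)
import Data.List.Properties as ListP
open import Data.List.Relation.Unary.All as All using (All; []; _∷_)
import Data.List.Relation.Unary.All.Properties as AllP
open import Data.List.Relation.Unary.Any as Any using (Any; here; there)
open import Data.List.Relation.Unary.AllPairs as AllPairs using (AllPairs; []; _∷_)
import Data.List.Relation.Unary.AllPairs.Properties as AllPairsP
open import Data.List.Relation.Unary.Unique.Propositional using (Unique)
import Data.List.Relation.Unary.Unique.Propositional.Properties as UniqueP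
open import Data.List.Membership.Propositional as LM using ()
import Data.List.Membership.Propositional.Properties as LMP
open import Data.List.Relation.Binary.Permutation.Propositional as Perm using (_↭_; ↭-refl; ↭-sym; ↭-trans; prep; swap)
import Data.List.Relation.Binary.Permutation.Propositional.Properties as PermP
open import Data.Product using (Σ; ∃; _×_; _,_; proj₁; proj₂)
open import Data.Sum using (_⊎_; inj₁; inj₂; [_,_]′)
open import Data.Empty using () renaming (⊥ to Empty)
open import Data.Unit using (⊤; tt)
open import Function using (_∘_; id; case_of_)
open import Induction.WellFounded using (Acc; acc)
open import Relation.Binary.Definitions using (tri<; tri≈; tri>)
open import Relation.Nullary using (¬_; Dec; yes; no; contradiction; does)
open import Relation.Nullary.Decidable using (_×-dec_; ¬?)
open import Relation.Binary.PropositionalEquality using (_≡_; _≢_; refl; sym; trans; cong; cong₂; subst; subst₂; module ≡-Reasoning)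
import Data.Fin.Induction as FinI

-- `HasDefect` and `HasLabel` quantify over the normal forms of a vector, while defects,
-- permutations and labels live on lists of factors. Independence is therefore proved for
-- combinations of lists that vanish at every integer point, and vectors are tied to lists through
-- the functionals `E p`. Two normal forms of one vector are then compared by rigidity: if one is
-- defect-free, all defect-free parts of the other carry its label, and the leading coefficient 1
-- leaves room for a single part. So a defect in one normal form excludes a defect-free one, and two
-- defect-free ones have the same label.
--
-- Points have integer coordinates for three reasons: the resolving identities become ring
-- identities over ℤ with signs as variables, the measure that decreases is a natural number, and an
-- equation 1 = N z forces N = 1.

-- The embedding of the integers into the rationals

ι : ℤ → ℚ
ι z = z / 1

private
  coprime-1 : ∀ m → Coprime m 1
  coprime-1 m = coprime-sym (1-coprimeTo m)

-- `_/_` normalises by a gcd, which is stuck on a variable numerator. In the `mkℚ` form with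
-- denominator 1 sums and products of rationals compute, and the homomorphism laws follow.
ι-mkℚ : ∀ z → ι z ≡ ℚ.mkℚ z 0 (coprime-1 ℤ.∣ z ∣)
ι-mkℚ z = ℚP.↥p/↧p≡p (ℚ.mkℚ z 0 (coprime-1 ℤ.∣ z ∣))

ι-+ : ∀ a b → ι (a ℤ.+ b) ≡ ι a ℚ.+ ι b
ι-+ a b = begin
  (a ℤ.+ b) / 1                        ≡⟨ cong (_/ 1) (cong₂ ℤ._+_ (sym (ℤP.*-identityʳ a)) (sym (ℤP.*-identityʳ b))) ⟩
  (a ℤ.* 1ℤ ℤ.+ b ℤ.* 1ℤ) / 1          ≡⟨ cong₂ ℚ._+_ (ι-mkℚ a) (ι-mkℚ b) ⟨
  ι a ℚ.+ ι b ∎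
  where open ≡-Reasoning

ι-* : ∀ a b → ι (a ℤ.* b) ≡ ι a ℚ.* ι b
ι-* a b = sym (cong₂ ℚ._*_ (ι-mkℚ a) (ι-mkℚ b))

ι-injective : ∀ {a b} → ι a ≡ ι b → a ≡ b
ι-injective {a} {b} eq = cong (λ q → ℚ.numerator q) (trans (sym (ι-mkℚ a)) (trans eq (ι-mkℚ b)))

ι-pos : ∀ {z} → 0ℤ ℤ.< z → 0ℚ ℚ.< ι z
ι-pos {z} 0<z = subst (0ℚ ℚ.<_) (sym (ι-mkℚ z))
  (ℚ.*<* {0ℚ} {ℚ.mkℚ z 0 (coprime-1 ℤ.∣ z ∣)} (subst (0ℤ ℤ.<_) (sym (ℤP.*-identityʳ z)) 0<z))

0<1 : 0ℚ ℚ.< 1ℚ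
0<1 = ι-pos {1ℤ} (ℤ.+<+ (s≤s z≤n))

-- Finite sums over all vectors with entries in a two-element type

module VecSum {A : Set} (x y : A) (x≢y : x ≢ y) (exhaust : ∀ a → a ≡ x ⊎ a ≡ y) where

  -- Instantiated with `true`, `false` for sums over monomials and with `one`, `two` for sums over
  -- labels.
  sumV : ∀ n → (Vec A n → ℚ) → ℚ
  sumV zero F = F []
  sumV (suc n) F = sumV n (F ∘ (x ∷_)) ℚ.+ sumV n (F ∘ (y ∷_))

  sumV-cong : ∀ n {F G : Vec A n → ℚ} → (∀ v → F v ≡ G v) → sumV n F ≡ sumV n G
  sumV-cong zero eq = eq []
  sumV-cong (suc n) eq = cong₂ ℚ._+_ (sumV-cong n (eq ∘ (x ∷_))) (sumV-cong n (eq ∘ (y ∷_)))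

  sumV-zero : ∀ n {F : Vec A n → ℚ} → (∀ v → F v ≡ 0ℚ) → sumV n F ≡ 0ℚ
  sumV-zero zero eq = eq []
  sumV-zero (suc n) eq = cong₂ ℚ._+_ (sumV-zero n (eq ∘ (x ∷_))) (sumV-zero n (eq ∘ (y ∷_)))

  sumV-linear : ∀ n c (F G : Vec A n → ℚ) →
    sumV n (λ v → c ℚ.* F v ℚ.+ G v) ≡ c ℚ.* sumV n F ℚ.+ sumV n G
  sumV-linear zero c F G = refl
  sumV-linear (suc n) c F G = trans
    (cong₂ ℚ._+_ (sumV-linear n c (F ∘ (x ∷_)) (G ∘ (x ∷_))) (sumV-linear n c (F ∘ (y ∷_)) (G ∘ (y ∷_))))
    (solve 5 (λ c a b d e → ((c :* a :+ b) :+ (c :* d :+ e)) := (c :* (a :+ d) :+ (b :+ e))) refl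
      c (sumV n (F ∘ (x ∷_))) (sumV n (G ∘ (x ∷_))) (sumV n (F ∘ (y ∷_))) (sumV n (G ∘ (y ∷_))))
    where open +-*-Solver

  sumV-single : ∀ n (F : Vec A n → ℚ) w → (∀ v → v ≢ w → F v ≡ 0ℚ) → sumV n F ≡ F w
  sumV-single zero F [] _ = refl
  sumV-single (suc n) F (a ∷ w) off with exhaust a
  ... | inj₁ refl = trans
    (cong₂ ℚ._+_ (sumV-single n (F ∘ (x ∷_)) w (λ v v≢w → off (x ∷ v) (v≢w ∘ VecP.∷-injectiveʳ)))
                 (sumV-zero n (λ v → off (y ∷ v) (x≢y ∘ sym ∘ VecP.∷-injectiveˡ))))
    (ℚP.+-identityʳ _)
  ... | inj₂ refl = trans
    (cong₂ ℚ._+_ (sumV-zero n (λ v → off (x ∷ v) (x≢y ∘ VecP.∷-injectiveˡ)))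
                 (sumV-single n (F ∘ (y ∷_)) w (λ v v≢w → off (y ∷ v) (v≢w ∘ VecP.∷-injectiveʳ))))
    (ℚP.+-identityˡ _)

exhaustBool : ∀ b → b ≡ true ⊎ b ≡ false
exhaustBool true = inj₁ refl
exhaustBool false = inj₂ refl

exhaustLetter : ∀ a → a ≡ one ⊎ a ≡ two
exhaustLetter one = inj₁ refl
exhaustLetter two = inj₂ refl

module SubsetSum = VecSum true false (λ ()) exhaustBool
module WordSum = VecSum one two (λ ()) exhaustLetter

-- Evaluation of products of linear factors

sgnℤ : Sgn → ℤ
sgnℤ plus = 1ℤ
sgnℤ minus = ℤ.- 1ℤ

sgnℤ-sgnQ : ∀ s → ι (sgnℤ s) ≡ sgnQ s
sgnℤ-sgnQ plus = refl
sgnℤ-sgnQ minus = refl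

Point : ℕ → Set
Point n = Fin n → ℤ

evF : ∀ {n} → Point n → Factor n → ℤ
evF p (s , a , t , b) = sgnℤ s ℤ.* p a ℤ.+ sgnℤ t ℤ.* p b

ev : ∀ {n} → Point n → List (Factor n) → ℤ
ev p [] = 1ℤ
ev p (f ∷ F) = evF p f ℤ.* ev p F

mon : ∀ {n} → Point n → Subset n → ℤ
mon p [] = 1ℤ
mon p (true ∷ S) = p zero ℤ.* mon (p ∘ suc) S
mon p (false ∷ S) = mon (p ∘ suc) S

ind : ∀ {n} → Subset n → Point n
ind I i = if lookup I i then 1ℤ else 0ℤ

mon-⊥ : ∀ {n} (p : Point n) → mon p ⊥ ≡ 1ℤ
mon-⊥ {zero} p = refl
mon-⊥ {suc n} p = mon-⊥ (p ∘ suc)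

mon-insert : ∀ {n} (p : Point n) a S → a ∉ S → mon p (⁅ a ⁆ ∪ S) ≡ p a ℤ.* mon p S
mon-insert p zero (true ∷ S) a∉S = contradiction here a∉S
mon-insert p zero (false ∷ S) a∉S = cong (λ T → p zero ℤ.* mon (p ∘ suc) T) (SubP.∪-identityˡ S)
mon-insert p (suc a) (true ∷ S) a∉S = trans
  (cong (p zero ℤ.*_) (mon-insert (p ∘ suc) a S (a∉S ∘ there)))
  (swap-* (p zero) (p (suc a)) _)
  where
  swap-* : ∀ x y z → x ℤ.* (y ℤ.* z) ≡ y ℤ.* (x ℤ.* z)
  swap-* = ℤR.solve-∀
mon-insert p (suc a) (false ∷ S) a∉S = mon-insert (p ∘ suc) a S (a∉S ∘ there)

∣insert∣ : ∀ {n} a (S : Subset n) → a ∉ S → ∣ ⁅ a ⁆ ∪ S ∣ ≡ suc ∣ S ∣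
∣insert∣ zero (true ∷ S) a∉S = contradiction here a∉S
∣insert∣ zero (false ∷ S) a∉S = cong (suc ∘ ∣_∣) (SubP.∪-identityˡ S)
∣insert∣ (suc a) (true ∷ S) a∉S = cong suc (∣insert∣ a S (a∉S ∘ there))
∣insert∣ (suc a) (false ∷ S) a∉S = ∣insert∣ a S (a∉S ∘ there)

mon-ind-self : ∀ {n} (I : Subset n) → mon (ind I) I ≡ 1ℤ
mon-ind-self [] = refl
mon-ind-self (true ∷ I) = trans (ℤP.*-identityˡ _) (mon-ind-self I)
mon-ind-self (false ∷ I) = mon-ind-self I

-- The value is nonzero only if S is contained in I, and then the inequality of sizes forces
-- equality. Unlike an equality of sizes, the inequality survives the removal of an index of I
-- outside S.
mon-ind-other : ∀ {n} (I S : Subset n) → ∣ I ∣ ≤ ∣ S ∣ → S ≡ I ⊎ mon (ind I) S ≡ 0ℤ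
mon-ind-other [] [] _ = inj₁ refl
mon-ind-other (true ∷ I) (true ∷ S) (s≤s le) with mon-ind-other I S le
... | inj₁ eq = inj₁ (cong (true ∷_) eq)
... | inj₂ eq = inj₂ (trans (ℤP.*-identityˡ _) eq)
mon-ind-other (false ∷ I) (true ∷ S) le = inj₂ refl
mon-ind-other (true ∷ I) (false ∷ S) le with mon-ind-other I S (ℕP.<⇒≤ le)
... | inj₁ refl = contradiction le (ℕP.<-irrefl refl)
... | inj₂ eq = inj₂ eq
mon-ind-other (false ∷ I) (false ∷ S) le with mon-ind-other I S le
... | inj₁ eq = inj₁ (cong (false ∷_) eq)
... | inj₂ eq = inj₂ eq

Terms : ℕ → Set
Terms n = List (ℚ × Subset n)

-- A global copy of the local function of `terms`, open to induction on the list of terms.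
expand : ∀ {n} → Factor n → Terms n → Terms n
expand f [] = []
expand f@(s , a , t , b) ((c , S) ∷ ts) =
  (sgnQ s ℚ.* c , ⁅ a ⁆ ∪ S) ∷ (sgnQ t ℚ.* c , ⁅ b ⁆ ∪ S) ∷ expand f ts

mutual
  terms-∷ : ∀ {n} (f : Factor n) F → terms (f ∷ F) ≡ expand f (terms F)
  terms-∷ (s , a , t , b) F with terms F
  -- With `terms F` generalised to a variable, this use determines the underscore in the type of
  -- `go≡expand` by unification.
  ... | ts = go≡expand s a t b F ts

  -- The underscore is the local function of `terms`, which has no name outside its module.
  go≡expand : ∀ {n} (s : Sgn) (a : Fin n) (t : Sgn) (b : Fin n) (F : List (Factor n)) (ts : Terms n) →
    _ ≡ expand (s , a , t , b) ts
  go≡expand s a t b F [] = refl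
  go≡expand s a t b F ((c , S) ∷ ts) = cong (λ z → _ ∷ _ ∷ z) (go≡expand s a t b F ts)

-- What remains of "S takes one end of each factor": the size makes coefficients readable at
-- indicators, the inclusion keeps inserted variables new, and the last clause is for the leading
-- monomial.
TermOf : ∀ {n} → List (Factor n) → Subset n → Set
TermOf F S = ∣ S ∣ ≡ length F
  × (∀ {x} → x ∈ S → x LM.∈ indices F)
  × All (λ { (s , a , t , b) → ¬ (a ∈ S × b ∈ S) }) F

indices-left : ∀ {n} {F : List (Factor n)} {s a t b} → (s , a , t , b) ∈F F → a LM.∈ indices F
indices-left (here refl) = here refl
indices-left (there m) = there (there (indices-left m))

indices-right : ∀ {n} {F : List (Factor n)} {s a t b} → (s , a , t , b) ∈F F → b LM.∈ indices F
indices-right (here refl) = there (here refl)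
indices-right (there m) = there (there (indices-right m))

All≢⇒∉ : ∀ {n} {x : Fin n} {xs} → All (x ≢_) xs → ¬ (x LM.∈ xs)
All≢⇒∉ = AllP.All¬⇒¬Any

∈-insert : ∀ {n} {a x : Fin n} {S} → x ∈ ⁅ a ⁆ ∪ S → x ≡ a ⊎ x ∈ S
∈-insert {a = a} {S = S} m with SubP.x∈p∪q⁻ ⁅ a ⁆ S m
... | inj₁ h = inj₁ (SubP.x∈⁅y⁆⇒x≡y _ h)
... | inj₂ h = inj₂ h

insert-TermOf : ∀ {n} {F : List (Factor n)} {S s a t b c} → c ≡ a ⊎ c ≡ b →
  Unique (indices ((s , a , t , b) ∷ F)) → TermOf F S → TermOf ((s , a , t , b) ∷ F) (⁅ c ⁆ ∪ S)
insert-TermOf {F = F} {S} {s} {a} {t} {b} {c} c∈ ((a≢b ∷ a∉) ∷ b∉ ∷ u) (size , sub , sep) =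
  trans (∣insert∣ c S c∉S) (cong suc size) , sub′ , bad-ab ∷ All.tabulate sep′
  where
  a∉F = All≢⇒∉ a∉
  b∉F = All≢⇒∉ b∉
  c∉F : ¬ (c LM.∈ indices F)
  c∉F = [ (λ { refl → a∉F }) , (λ { refl → b∉F }) ]′ c∈
  c∉S = c∉F ∘ sub
  sub′ : ∀ {x} → x ∈ ⁅ c ⁆ ∪ S → x LM.∈ a ∷ b ∷ indices F
  sub′ m with ∈-insert m
  ... | inj₁ refl = [ here , (λ e → there (here e)) ]′ c∈
  ... | inj₂ m′ = there (there (sub m′))
  bad-ab : ¬ (a ∈ ⁅ c ⁆ ∪ S × b ∈ ⁅ c ⁆ ∪ S)
  bad-ab (ma , mb) with ∈-insert ma | ∈-insert mb
  ... | inj₁ refl | inj₁ refl = a≢b refl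
  ... | inj₂ m | _ = a∉F (sub m)
  ... | inj₁ _ | inj₂ m = b∉F (sub m)
  sep′ : ∀ {f} → f ∈F F → ¬ (proj₁ (proj₂ f) ∈ ⁅ c ⁆ ∪ S × proj₂ (proj₂ (proj₂ f)) ∈ ⁅ c ⁆ ∪ S)
  sep′ f∈ (m₁ , m₂) with ∈-insert m₁ | ∈-insert m₂
  ... | inj₁ refl | _ = c∉F (indices-left f∈)
  ... | inj₂ _ | inj₁ refl = c∉F (indices-right f∈)
  ... | inj₂ m₁′ | inj₂ m₂′ = All.lookup sep f∈ (m₁′ , m₂′)

expand-TermOf : ∀ {n} {F : List (Factor n)} {f} → Unique (indices (f ∷ F)) → ∀ ts →
  All (TermOf F ∘ proj₂) ts → All (TermOf (f ∷ F) ∘ proj₂) (expand f ts)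
expand-TermOf u [] [] = []
expand-TermOf u ((c , S) ∷ ts) (ok ∷ oks) =
  insert-TermOf (inj₁ refl) u ok ∷ insert-TermOf (inj₂ refl) u ok ∷ expand-TermOf u ts oks

terms-TermOf : ∀ {n} (F : List (Factor n)) → Unique (indices F) → All (TermOf F ∘ proj₂) (terms F)
terms-TermOf {n} [] u = (SubP.∣⊥∣≡0 n , (λ x∈⊥ → contradiction x∈⊥ SubP.∉⊥) , []) ∷ []
terms-TermOf (f ∷ F) u@(_ ∷ _ ∷ u′) = subst (All (TermOf (f ∷ F) ∘ proj₂)) (sym (terms-∷ f F))
  (expand-TermOf u (terms F) (terms-TermOf F u′))

evT : ∀ {n} → Point n → Terms n → ℚ
evT p [] = 0ℚ
evT p ((c , S) ∷ ts) = c ℚ.* ι (mon p S) ℚ.+ evT p ts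

-- Distinct indices make every inserted variable new, so that enlarging the set by an index is
-- multiplication of the monomial by its variable.
evT-expand : ∀ {n} (p : Point n) (f : Factor n) F → Unique (indices (f ∷ F)) → ∀ ts →
  All (TermOf F ∘ proj₂) ts → evT p (expand f ts) ≡ ι (evF p f) ℚ.* evT p ts
evT-expand p f F u [] _ = sym (ℚP.*-zeroʳ (ι (evF p f)))
evT-expand p f@(s , a , t , b) F u@((_ ∷ a∉) ∷ b∉ ∷ _) ((c , S) ∷ ts) ((_ , sub , _) ∷ oks) = begin
  sgnQ s ℚ.* c ℚ.* ι (mon p (⁅ a ⁆ ∪ S)) ℚ.+ (sgnQ t ℚ.* c ℚ.* ι (mon p (⁅ b ⁆ ∪ S)) ℚ.+ evT p (expand f ts))
    ≡⟨ cong₂ (λ x y → sgnQ s ℚ.* c ℚ.* x ℚ.+ (sgnQ t ℚ.* c ℚ.* y ℚ.+ evT p (expand f ts)))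
         (trans (cong ι (mon-insert p a S (All≢⇒∉ a∉ ∘ sub))) (ι-* (p a) (mon p S)))
         (trans (cong ι (mon-insert p b S (All≢⇒∉ b∉ ∘ sub))) (ι-* (p b) (mon p S))) ⟩
  sgnQ s ℚ.* c ℚ.* (ι (p a) ℚ.* M) ℚ.+ (sgnQ t ℚ.* c ℚ.* (ι (p b) ℚ.* M) ℚ.+ evT p (expand f ts))
    ≡⟨ cong (λ z → sgnQ s ℚ.* c ℚ.* (ι (p a) ℚ.* M) ℚ.+ (sgnQ t ℚ.* c ℚ.* (ι (p b) ℚ.* M) ℚ.+ z))
         (evT-expand p f F u ts oks) ⟩
  sgnQ s ℚ.* c ℚ.* (ι (p a) ℚ.* M) ℚ.+ (sgnQ t ℚ.* c ℚ.* (ι (p b) ℚ.* M) ℚ.+ ι (evF p f) ℚ.* evT p ts)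
    ≡⟨ cong (λ z → sgnQ s ℚ.* c ℚ.* (ι (p a) ℚ.* M) ℚ.+ (sgnQ t ℚ.* c ℚ.* (ι (p b) ℚ.* M) ℚ.+ z ℚ.* evT p ts)) ι-evF ⟩
  sgnQ s ℚ.* c ℚ.* (ι (p a) ℚ.* M) ℚ.+ (sgnQ t ℚ.* c ℚ.* (ι (p b) ℚ.* M) ℚ.+ E ℚ.* evT p ts)
    ≡⟨ solve 7 (λ s c a M t b r →
         (s :* c :* (a :* M) :+ (t :* c :* (b :* M) :+ (s :* a :+ t :* b) :* r))
         := ((s :* a :+ t :* b) :* (c :* M :+ r))) refl
         (sgnQ s) c (ι (p a)) M (sgnQ t) (ι (p b)) (evT p ts) ⟩
  E ℚ.* (c ℚ.* M ℚ.+ evT p ts) ≡⟨ cong (ℚ._* (c ℚ.* M ℚ.+ evT p ts)) ι-evF ⟨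
  ι (evF p f) ℚ.* (c ℚ.* M ℚ.+ evT p ts) ∎
  where
  open ≡-Reasoning
  open +-*-Solver
  M = ι (mon p S)
  E = sgnQ s ℚ.* ι (p a) ℚ.+ sgnQ t ℚ.* ι (p b)
  ι-evF : ι (evF p f) ≡ E
  ι-evF = trans (ι-+ (sgnℤ s ℤ.* p a) (sgnℤ t ℤ.* p b)) (cong₂ ℚ._+_
    (trans (ι-* (sgnℤ s) (p a)) (cong (ℚ._* ι (p a)) (sgnℤ-sgnQ s)))
    (trans (ι-* (sgnℤ t) (p b)) (cong (ℚ._* ι (p b)) (sgnℤ-sgnQ t))))

evT-terms : ∀ {n} (p : Point n) (F : List (Factor n)) → Unique (indices F) → evT p (terms F) ≡ ι (ev p F)
evT-terms p [] u = cong (λ z → 1ℚ ℚ.* ι z ℚ.+ 0ℚ) (mon-⊥ p)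
evT-terms p (f ∷ F) u@(_ ∷ _ ∷ u′) = begin
  evT p (terms (f ∷ F))          ≡⟨ cong (evT p) (terms-∷ f F) ⟩
  evT p (expand f (terms F))     ≡⟨ evT-expand p f F u (terms F) (terms-TermOf F u′) ⟩
  ι (evF p f) ℚ.* evT p (terms F) ≡⟨ cong (ι (evF p f) ℚ.*_) (evT-terms p F u′) ⟩
  ι (evF p f) ℚ.* ι (ev p F)     ≡⟨ ι-* (evF p f) (ev p F) ⟨
  ι (ev p (f ∷ F)) ∎
  where open ≡-Reasoning

coeffAt-evT : ∀ {n} (I : Subset n) ts → All (λ cS → ∣ proj₂ cS ∣ ≡ ∣ I ∣) ts → coeffAt I ts ≡ evT (ind I) ts
coeffAt-evT I [] [] = refl
coeffAt-evT I ((c , S) ∷ ts) (eq ∷ eqs) with VecP.≡-dec _≟B_ S I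
... | yes refl = cong₂ ℚ._+_
  (sym (trans (cong (λ z → c ℚ.* ι z) (mon-ind-self I)) (ℚP.*-identityʳ c)))
  (coeffAt-evT I ts eqs)
... | no S≢I with mon-ind-other I S (ℕP.≤-reflexive (sym eq))
...   | inj₁ S≡I = contradiction S≡I S≢I
...   | inj₂ m≡0 = trans (coeffAt-evT I ts eqs) (sym (trans
  (cong (λ z → c ℚ.* ι z ℚ.+ evT (ind I) ts) m≡0)
  (trans (cong (ℚ._+ evT (ind I) ts) (ℚP.*-zeroʳ c)) (ℚP.+-identityˡ _))))

-- A monomial of degree k equals 1 at the indicator of its own index set and 0 at that of
-- any other k-set, so the coefficients of a k-root are its values at indicators.
poly-ev : ∀ {n k} (fs : Vec (Factor n) k) → Unique (indices (toList fs)) → ∀ I →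
  poly fs I ≡ ι (ev (ind (proj₁ I)) (toList fs))
poly-ev fs u (I , ∣I∣≡k) = trans
  (coeffAt-evT I (terms (toList fs)) (All.map (λ {cS} → size {cS}) (terms-TermOf (toList fs) u)))
  (evT-terms (ind I) (toList fs) u)
  where
  size : ∀ {cS} → TermOf (toList fs) (proj₂ cS) → ∣ proj₂ cS ∣ ≡ ∣ I ∣
  size (eq , _) = trans eq (trans (VecP.length-toList fs) (sym ∣I∣≡k))

-- Values at arbitrary points as functions of the coefficients

𝟙 : {P : Set} → Dec P → ℚ
𝟙 (yes _) = 1ℚ
𝟙 (no _) = 0ℚ

𝟙-yes : {P : Set} {d : Dec P} → P → 𝟙 d ≡ 1ℚ
𝟙-yes {d = yes _} _ = refl
𝟙-yes {d = no ¬p} p = contradiction p ¬p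

𝟙-no : {P : Set} {d : Dec P} → ¬ P → 𝟙 d ≡ 0ℚ
𝟙-no {d = yes p} ¬p = contradiction p ¬p
𝟙-no {d = no _} _ = refl

_≟Sub_ : ∀ {n} (S I : Subset n) → Dec (S ≡ I)
_≟Sub_ = VecP.≡-dec _≟B_

coeffAt-∷ : ∀ {n} (I : Subset n) c S ts → coeffAt I ((c , S) ∷ ts) ≡ c ℚ.* 𝟙 (S ≟Sub I) ℚ.+ coeffAt I ts
coeffAt-∷ I c S ts with VecP.≡-dec _≟B_ S I
... | yes _ = cong (ℚ._+ coeffAt I ts) (sym (ℚP.*-identityʳ c))
... | no _ = sym (trans (cong (ℚ._+ coeffAt I ts) (ℚP.*-zeroʳ c)) (ℚP.+-identityˡ _))

coeffAt-zero : ∀ {n} (I : Subset n) ts → All (λ cS → proj₂ cS ≢ I) ts → coeffAt I ts ≡ 0ℚ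
coeffAt-zero I [] [] = refl
coeffAt-zero I ((c , S) ∷ ts) (S≢I ∷ rest) with VecP.≡-dec _≟B_ S I
... | yes S≡I = contradiction S≡I S≢I
... | no _ = coeffAt-zero I ts rest

evT-sum : ∀ {n} (p : Point n) ts → evT p ts ≡ SubsetSum.sumV n (λ I → coeffAt I ts ℚ.* ι (mon p I))
evT-sum {n} p [] = sym (SubsetSum.sumV-zero n (λ I → ℚP.*-zeroˡ (ι (mon p I))))
evT-sum {n} p ((c , S) ∷ ts) = sym (begin
  sumV n (λ I → coeffAt I ((c , S) ∷ ts) ℚ.* ι (mon p I))
    ≡⟨ sumV-cong n (λ I → trans (cong (ℚ._* ι (mon p I)) (coeffAt-∷ I c S ts))
         (solve 4 (λ c d r m → (c :* d :+ r) :* m := c :* (d :* m) :+ r :* m) refl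
            c (𝟙 (S ≟Sub I)) (coeffAt I ts) (ι (mon p I)))) ⟩
  sumV n (λ I → c ℚ.* (𝟙 (S ≟Sub I) ℚ.* ι (mon p I)) ℚ.+ coeffAt I ts ℚ.* ι (mon p I))
    ≡⟨ sumV-linear n c (λ I → 𝟙 (S ≟Sub I) ℚ.* ι (mon p I)) (λ I → coeffAt I ts ℚ.* ι (mon p I)) ⟩
  c ℚ.* sumV n (λ I → 𝟙 (S ≟Sub I) ℚ.* ι (mon p I)) ℚ.+ sumV n (λ I → coeffAt I ts ℚ.* ι (mon p I))
    ≡⟨ cong₂ (λ x y → c ℚ.* x ℚ.+ y)
         (trans (sumV-single n _ S (λ I I≢S → trans (cong (ℚ._* ι (mon p I)) (𝟙-no {d = S ≟Sub I} (I≢S ∘ sym))) (ℚP.*-zeroˡ (ι (mon p I)))))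
                (trans (cong (ℚ._* ι (mon p S)) (𝟙-yes {d = S ≟Sub S} refl)) (ℚP.*-identityˡ _)))
         (sym (evT-sum p ts)) ⟩
  c ℚ.* ι (mon p S) ℚ.+ evT p ts ∎)
  where
  open ≡-Reasoning
  open +-*-Solver
  open SubsetSum

-- The default 0 off size k turns a sum over k-sets into a sum over all vectors of Booleans.
ext : ∀ {n k} → V n k → Subset n → ℚ
ext {k = k} v I with ∣ I ∣ ℕ.≟ k
... | yes e = v (I , e)
... | no _ = 0ℚ

ext-KSet : ∀ {n k} (v : V n k) I (e : ∣ I ∣ ≡ k) → ext v I ≡ v (I , e)
ext-KSet {k = k} v I e with ∣ I ∣ ℕ.≟ k
... | yes e′ = cong (λ z → v (I , z)) (ℕP.≡-irrelevant e′ e)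
... | no ne = contradiction e ne

-- The linear extension to V of evaluating squarefree monomials at p.
E : ∀ {n k} → Point n → V n k → ℚ
E {n} p v = SubsetSum.sumV n (λ I → ext v I ℚ.* ι (mon p I))

E-cong : ∀ {n k} (p : Point n) {u v : V n k} → u ≈V v → E p u ≡ E p v
E-cong {n} {k} p {u} {v} eq = SubsetSum.sumV-cong n (λ I → cong (ℚ._* ι (mon p I)) (ext-cong I))
  where
  ext-cong : ∀ I → ext u I ≡ ext v I
  ext-cong I with ∣ I ∣ ℕ.≟ k
  ... | yes e = eq (I , e)
  ... | no _ = refl

E-zero : ∀ {n k} (p : Point n) → E p (zeroV {n} {k}) ≡ 0ℚ
E-zero {n} {k} p = SubsetSum.sumV-zero n (λ I → trans (cong (ℚ._* ι (mon p I)) (ext-zero I)) (ℚP.*-zeroˡ (ι (mon p I))))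
  where
  ext-zero : ∀ I → ext (zeroV {n} {k}) I ≡ 0ℚ
  ext-zero I with ∣ I ∣ ℕ.≟ k
  ... | yes e = refl
  ... | no _ = refl

E-∷ : ∀ {n k} (p : Point n) c (v : V n k) L → E p (lincomb ((c , v) ∷ L)) ≡ c ℚ.* E p v ℚ.+ E p (lincomb L)
E-∷ {n} {k} p c v L = trans
  (SubsetSum.sumV-cong n (λ I → trans (cong (ℚ._* ι (mon p I)) (ext-∷ I))
    (solve 4 (λ c d r m → (c :* d :+ r) :* m := c :* (d :* m) :+ r :* m) refl
       c (ext v I) (ext (lincomb L) I) (ι (mon p I)))))
  (SubsetSum.sumV-linear n c (λ I → ext v I ℚ.* ι (mon p I)) (λ I → ext (lincomb L) I ℚ.* ι (mon p I)))
  where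
  open +-*-Solver
  ext-∷ : ∀ I → ext (lincomb ((c , v) ∷ L)) I ≡ c ℚ.* ext v I ℚ.+ ext (lincomb L) I
  ext-∷ I with ∣ I ∣ ℕ.≟ k
  ... | yes e = refl
  ... | no _ = sym (trans (cong (ℚ._+ 0ℚ) (ℚP.*-zeroʳ c)) (ℚP.+-identityˡ 0ℚ))

-- Hence the value of a k-root at any integer point depends on the vector alone, so equations in V
-- can be tested at points such as `descending n` and `wordPoint w`, which are not indicators.
E-poly : ∀ {n k} (p : Point n) (fs : Vec (Factor n) k) → Unique (indices (toList fs)) →
  E p (poly fs) ≡ ι (ev p (toList fs))
E-poly {n} {k} p fs u = begin
  E p (poly fs)  ≡⟨ SubsetSum.sumV-cong n (λ I → cong (ℚ._* ι (mon p I)) (ext-poly I)) ⟩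
  SubsetSum.sumV n (λ I → coeffAt I (terms F) ℚ.* ι (mon p I)) ≡⟨ evT-sum p (terms F) ⟨
  evT p (terms F) ≡⟨ evT-terms p F u ⟩
  ι (ev p F) ∎
  where
  open ≡-Reasoning
  F = toList fs
  ext-poly : ∀ I → ext (poly fs) I ≡ coeffAt I (terms F)
  ext-poly I with ∣ I ∣ ℕ.≟ k
  ... | yes e = refl
  ... | no ne = sym (coeffAt-zero I (terms F)
    (All.map (λ { (size , _) refl → ne (trans size (VecP.length-toList fs)) }) (terms-TermOf F u)))

-- Normal forms as lists of factors

-- The data of `NF` with the length as a proof instead of an index, so that permutations of lists
-- apply to the factors.
record IsNF {n} (k : ℕ) (F : List (Factor n)) : Set where
  constructor isNF
  field
    len : length F ≡ k
    uniq : Unique (indices F)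
    normal : All NormalFactor F
open IsNF public

indices-↭ : ∀ {n} {F G : List (Factor n)} → F ↭ G → indices F ↭ indices G
indices-↭ Perm.refl = ↭-refl
indices-↭ (prep (_ , a , _ , b) σ) = prep a (prep b (indices-↭ σ))
indices-↭ (swap (_ , a , _ , b) (_ , c , _ , d) σ) =
  ↭-trans (PermP.shifts (a ∷ b ∷ []) (c ∷ d ∷ [])) (prep c (prep d (prep a (prep b (indices-↭ σ)))))
indices-↭ (Perm.trans σ τ) = ↭-trans (indices-↭ σ) (indices-↭ τ)

Unique-↭ : ∀ {A : Set} {xs ys : List A} → xs ↭ ys → Unique xs → Unique ys
Unique-↭ Perm.refl u = u
Unique-↭ (prep x σ) (x∉ ∷ u) = PermP.All-resp-↭ σ x∉ ∷ Unique-↭ σ u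
Unique-↭ (swap x y σ) ((x≢y ∷ x∉) ∷ y∉ ∷ u) =
  ((x≢y ∘ sym) ∷ PermP.All-resp-↭ σ y∉) ∷ PermP.All-resp-↭ σ x∉ ∷ Unique-↭ σ u
Unique-↭ (Perm.trans σ τ) u = Unique-↭ τ (Unique-↭ σ u)

IsNF-↭ : ∀ {n k} {F G : List (Factor n)} → F ↭ G → IsNF k F → IsNF k G
IsNF-↭ σ (isNF l u nf) =
  isNF (trans (sym (PermP.↭-length σ)) l) (Unique-↭ (indices-↭ σ) u) (PermP.All-resp-↭ σ nf)

ev-↭ : ∀ {n} (p : Point n) {F G : List (Factor n)} → F ↭ G → ev p F ≡ ev p G
ev-↭ p Perm.refl = refl
ev-↭ p (prep f σ) = cong (evF p f ℤ.*_) (ev-↭ p σ)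
ev-↭ p (swap f g σ) = trans (cong (λ z → evF p f ℤ.* (evF p g ℤ.* z)) (ev-↭ p σ)) (exchange (evF p f) (evF p g) _)
  where
  exchange : ∀ x y z → x ℤ.* (y ℤ.* z) ≡ y ℤ.* (x ℤ.* z)
  exchange = ℤR.solve-∀
ev-↭ p (Perm.trans σ τ) = trans (ev-↭ p σ) (ev-↭ p τ)

-- Defects and the identities that resolve them

Crossing Nested : ∀ {n} → Factor n → Factor n → Set
Crossing (_ , i , _ , r) (_ , j , _ , s) = i Fin.< j × j Fin.< r × r Fin.< s
Nested (_ , i , _ , s) (_ , j , t , r) = t ≡ plus × i Fin.< j × j Fin.< r × r Fin.< s

GapInside GapAfter : ∀ {n} → List (Factor n) → Factor n → Set
GapInside F (_ , i , _ , r) = ∃ λ j → i Fin.< j × j Fin.< r × Unused j F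
GapAfter F (_ , i , t , j) = t ≡ plus × ∃ λ r → j Fin.< r × Unused r F

-- The four cases of `Defect` through `Any`, which makes them decidable by a search. The sign of a
-- left end is left out; `NormalFactor` supplies it.
data Defective {n} (F : List (Factor n)) : Set where
  crossing : Any (λ f → Any (Crossing f) F) F → Defective F
  nested : Any (λ f → Any (Nested f) F) F → Defective F
  gapInside : Any (GapInside F) F → Defective F
  gapAfter : Any (GapAfter F) F → Defective F

_≟S_ : (s t : Sgn) → Dec (s ≡ t)
plus ≟S plus = yes refl
plus ≟S minus = no λ ()
minus ≟S plus = no λ ()
minus ≟S minus = yes refl

unused? : ∀ {n} (j : Fin n) F → Dec (Unused j F)
unused? j F = ¬? (Any.any? (j Fin.≟_) (indices F))

defective? : ∀ {n} (F : List (Factor n)) → Dec (Defective F)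
defective? F
  with Any.any? (λ { (_ , i , _ , r) → Any.any? (λ { (_ , j , _ , s) → (i Fin.<? j) ×-dec (j Fin.<? r) ×-dec (r Fin.<? s) }) F }) F
... | yes d = yes (crossing d)
... | no d₁
  with Any.any? (λ { (_ , i , _ , s) → Any.any? (λ { (_ , j , t , r) →
         (t ≟S plus) ×-dec (i Fin.<? j) ×-dec (j Fin.<? r) ×-dec (r Fin.<? s) }) F }) F
... | yes d = yes (nested d)
... | no d₂
  with Any.any? (λ { (_ , i , _ , r) → FinP.any? (λ j → (i Fin.<? j) ×-dec (j Fin.<? r) ×-dec unused? j F) }) F
... | yes d = yes (gapInside d)
... | no d₃
  with Any.any? (λ { (_ , i , t , j) → (t ≟S plus) ×-dec FinP.any? (λ r → (j Fin.<? r) ×-dec unused? r F) }) F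
... | yes d = yes (gapAfter d)
... | no d₄ = no λ where
  (crossing d) → d₁ d
  (nested d) → d₂ d
  (gapInside d) → d₃ d
  (gapAfter d) → d₄ d

evs : ∀ {n} → Point n → List (List (Factor n)) → ℤ
evs p [] = 0ℤ
evs p (G ∷ Gs) = ev p G ℤ.+ evs p Gs

evs-++ : ∀ {n} (p : Point n) Gs Hs → evs p (Gs ++ Hs) ≡ evs p Gs ℤ.+ evs p Hs
evs-++ p [] Hs = sym (ℤP.+-identityˡ _)
evs-++ p (G ∷ Gs) Hs = trans (cong (ℤ._+_ (ev p G)) (evs-++ p Gs Hs)) (sym (ℤP.+-assoc (ev p G) _ _))

-- With positive values at `descending n`, the field `several` makes each part strictly smaller than
-- F there. This gives termination and also shows that the parts differ from F.
record Resolution {n} (k : ℕ) (F : List (Factor n)) : Set where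
  constructor resolution
  field
    parts : List (List (Factor n))
    allNF : All (IsNF k) parts
    several : 2 ≤ length parts
    expansion : ∀ p → ev p F ≡ evs p parts

Resolution-↭ : ∀ {n k} {F G : List (Factor n)} → F ↭ G → Resolution k G → Resolution k F
Resolution-↭ σ (resolution Gs nfs two≤ eq) = resolution Gs nfs two≤ (λ p → trans (ev-↭ p σ) (eq p))

oppS : Sgn → Sgn → Sgn
oppS plus plus = minus
oppS plus minus = plus
oppS minus plus = plus
oppS minus minus = minus

sgnℤ-oppS : ∀ s t → sgnℤ (oppS s t) ≡ ℤ.- (sgnℤ s ℤ.* sgnℤ t)
sgnℤ-oppS plus plus = refl
sgnℤ-oppS plus minus = refl
sgnℤ-oppS minus plus = refl
sgnℤ-oppS minus minus = refl

∈-front : ∀ {A : Set} {x : A} {xs} → x LM.∈ xs → ∃ λ ys → xs ↭ x ∷ ys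
∈-front {x = x} x∈ with LMP.∈-∃++ x∈
... | ys , zs , refl = ys ++ zs , PermP.shift x ys zs

∈-front₂ : ∀ {A : Set} {x y : A} {xs} → x LM.∈ xs → y LM.∈ xs → x ≢ y → ∃ λ zs → xs ↭ x ∷ y ∷ zs
∈-front₂ {x = x} x∈ y∈ x≢y with ∈-front x∈
... | ys , σ with PermP.∈-resp-↭ σ y∈
...   | here refl = contradiction refl x≢y
...   | there y∈ys with ∈-front y∈ys
...     | zs , τ = zs , ↭-trans σ (prep x τ)

-- (x_i + t x_r)(x_j + u x_s) = (x_i - tu x_s)(x_j - x_r) + (x_i + t x_j)(x_r + u x_s). The left
-- side has no x_i x_r and no x_j x_s; the signs -1 and -tu cancel them on the right.
resolve-crossing : ∀ {n k} {i j r s : Fin n} {t u R} → i Fin.< j → j Fin.< r → r Fin.< s →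
  IsNF k ((plus , i , t , r) ∷ (plus , j , u , s) ∷ R) → Resolution k ((plus , i , t , r) ∷ (plus , j , u , s) ∷ R)
resolve-crossing {i = i} {j} {r} {s} {t} {u} {R} i<j j<r r<s (isNF l un (_ ∷ _ ∷ nf)) = resolution
  (((plus , i , oppS t u , s) ∷ (plus , j , minus , r) ∷ R) ∷ ((plus , i , t , j) ∷ (plus , r , u , s) ∷ R) ∷ [])
  ( isNF l (Unique-↭ σ₁ un) ((refl , FinP.<-trans i<j (FinP.<-trans j<r r<s)) ∷ (refl , j<r) ∷ nf)
  ∷ isNF l (Unique-↭ σ₂ un) ((refl , i<j) ∷ (refl , r<s) ∷ nf) ∷ [])
  (s≤s (s≤s z≤n))
  (λ p → trans (identity (sgnℤ t) (sgnℤ u) (p i) (p j) (p r) (p s) (ev p R))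
    (cong (λ z → (1ℤ ℤ.* p i ℤ.+ z ℤ.* p s) ℤ.* ((1ℤ ℤ.* p j ℤ.+ ℤ.- 1ℤ ℤ.* p r) ℤ.* ev p R)
       ℤ.+ ((1ℤ ℤ.* p i ℤ.+ sgnℤ t ℤ.* p j) ℤ.* ((1ℤ ℤ.* p r ℤ.+ sgnℤ u ℤ.* p s) ℤ.* ev p R) ℤ.+ 0ℤ))
      (sym (sgnℤ-oppS t u))))
  where
  σ₁ : i ∷ r ∷ j ∷ s ∷ indices R ↭ i ∷ s ∷ j ∷ r ∷ indices R
  σ₁ = prep i (↭-trans (PermP.shifts (r ∷ j ∷ []) (s ∷ [])) (prep s (swap r j ↭-refl)))
  σ₂ : i ∷ r ∷ j ∷ s ∷ indices R ↭ i ∷ j ∷ r ∷ s ∷ indices R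
  σ₂ = prep i (swap r j ↭-refl)
  identity : ∀ A B x y z w Q →
    (1ℤ ℤ.* x ℤ.+ A ℤ.* z) ℤ.* ((1ℤ ℤ.* y ℤ.+ B ℤ.* w) ℤ.* Q)
    ≡ (1ℤ ℤ.* x ℤ.+ ℤ.- (A ℤ.* B) ℤ.* w) ℤ.* ((1ℤ ℤ.* y ℤ.+ ℤ.- 1ℤ ℤ.* z) ℤ.* Q)
      ℤ.+ ((1ℤ ℤ.* x ℤ.+ A ℤ.* y) ℤ.* ((1ℤ ℤ.* z ℤ.+ B ℤ.* w) ℤ.* Q) ℤ.+ 0ℤ)
  identity = ℤR.solve-∀

-- The first two parts add up to 2 (x_i x_r + t x_j x_s). The third, which is the given pair with
-- both signs reversed, removes one copy of this and supplies x_i x_j + t x_r x_s.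
resolve-nested : ∀ {n k} {i j r s : Fin n} {t R} → i Fin.< j → j Fin.< r → r Fin.< s →
  IsNF k ((plus , i , t , s) ∷ (plus , j , plus , r) ∷ R) → Resolution k ((plus , i , t , s) ∷ (plus , j , plus , r) ∷ R)
resolve-nested {i = i} {j} {r} {s} {t} {R} i<j j<r r<s (isNF l un (_ ∷ _ ∷ nf)) = resolution
  ( ((plus , i , plus , j) ∷ (plus , r , t , s) ∷ R)
  ∷ ((plus , i , minus , j) ∷ (plus , r , oppS plus t , s) ∷ R)
  ∷ ((plus , i , oppS plus t , s) ∷ (plus , j , minus , r) ∷ R) ∷ [])
  ( isNF l (Unique-↭ σ₁ un) ((refl , i<j) ∷ (refl , r<s) ∷ nf)
  ∷ isNF l (Unique-↭ σ₁ un) ((refl , i<j) ∷ (refl , r<s) ∷ nf)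
  ∷ isNF l un ((refl , FinP.<-trans i<j (FinP.<-trans j<r r<s)) ∷ (refl , j<r) ∷ nf) ∷ [])
  (s≤s (s≤s z≤n))
  (λ p → trans (identity (sgnℤ t) (p i) (p j) (p r) (p s) (ev p R))
    (cong (λ z → (1ℤ ℤ.* p i ℤ.+ 1ℤ ℤ.* p j) ℤ.* ((1ℤ ℤ.* p r ℤ.+ sgnℤ t ℤ.* p s) ℤ.* ev p R)
        ℤ.+ ((1ℤ ℤ.* p i ℤ.+ ℤ.- 1ℤ ℤ.* p j) ℤ.* ((1ℤ ℤ.* p r ℤ.+ z ℤ.* p s) ℤ.* ev p R)
        ℤ.+ ((1ℤ ℤ.* p i ℤ.+ z ℤ.* p s) ℤ.* ((1ℤ ℤ.* p j ℤ.+ ℤ.- 1ℤ ℤ.* p r) ℤ.* ev p R) ℤ.+ 0ℤ)))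
      (sym (sgnℤ-oppS plus t))))
  where
  σ₁ : i ∷ s ∷ j ∷ r ∷ indices R ↭ i ∷ j ∷ r ∷ s ∷ indices R
  σ₁ = prep i (PermP.shifts (s ∷ []) (j ∷ r ∷ []))
  identity : ∀ A x y z w Q →
    (1ℤ ℤ.* x ℤ.+ A ℤ.* w) ℤ.* ((1ℤ ℤ.* y ℤ.+ 1ℤ ℤ.* z) ℤ.* Q)
    ≡ (1ℤ ℤ.* x ℤ.+ 1ℤ ℤ.* y) ℤ.* ((1ℤ ℤ.* z ℤ.+ A ℤ.* w) ℤ.* Q)
      ℤ.+ ((1ℤ ℤ.* x ℤ.+ ℤ.- 1ℤ ℤ.* y) ℤ.* ((1ℤ ℤ.* z ℤ.+ ℤ.- (1ℤ ℤ.* A) ℤ.* w) ℤ.* Q)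
      ℤ.+ ((1ℤ ℤ.* x ℤ.+ ℤ.- (1ℤ ℤ.* A) ℤ.* w) ℤ.* ((1ℤ ℤ.* y ℤ.+ ℤ.- 1ℤ ℤ.* z) ℤ.* Q) ℤ.+ 0ℤ))
  identity = ℤR.solve-∀

∉⇒All≢ : ∀ {n} {x : Fin n} {xs} → ¬ (x LM.∈ xs) → All (x ≢_) xs
∉⇒All≢ = AllP.¬Any⇒All¬ _

resolve-gapInside : ∀ {n k} {i j r : Fin n} {t R} → i Fin.< j → j Fin.< r →
  Unused j ((plus , i , t , r) ∷ R) →
  IsNF k ((plus , i , t , r) ∷ R) → Resolution k ((plus , i , t , r) ∷ R)
resolve-gapInside {i = i} {j} {r} {t} {R} i<j j<r j∉ (isNF l un (_ ∷ nf)) with Unique-↭ (swap j i ↭-refl) (∉⇒All≢ j∉ ∷ un)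
... | ((i≢j ∷ _ ∷ i∉R) ∷ (j≢r ∷ j∉R) ∷ r∉R ∷ uR) = resolution
  (((plus , i , minus , j) ∷ R) ∷ ((plus , j , t , r) ∷ R) ∷ [])
  ( isNF l ((i≢j ∷ i∉R) ∷ j∉R ∷ uR) ((refl , i<j) ∷ nf)
  ∷ isNF l ((j≢r ∷ j∉R) ∷ r∉R ∷ uR) ((refl , j<r) ∷ nf) ∷ [])
  (s≤s (s≤s z≤n))
  (λ p → identity (sgnℤ t) (p i) (p j) (p r) (ev p R))
  where
  identity : ∀ A x y z Q → (1ℤ ℤ.* x ℤ.+ A ℤ.* z) ℤ.* Q
    ≡ (1ℤ ℤ.* x ℤ.+ ℤ.- 1ℤ ℤ.* y) ℤ.* Q ℤ.+ ((1ℤ ℤ.* y ℤ.+ A ℤ.* z) ℤ.* Q ℤ.+ 0ℤ)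
  identity = ℤR.solve-∀

-- x_i + x_j = (x_i - x_j) + 2 x_j, and 2 x_j = (x_j - x_r) + (x_j + x_r).
resolve-gapAfter : ∀ {n k} {i j r : Fin n} {R} → i Fin.< j → j Fin.< r →
  Unused r ((plus , i , plus , j) ∷ R) →
  IsNF k ((plus , i , plus , j) ∷ R) → Resolution k ((plus , i , plus , j) ∷ R)
resolve-gapAfter {i = i} {j} {r} {R} i<j j<r r∉ (isNF l un (_ ∷ nf)) with Unique-↭ (PermP.shifts (r ∷ []) (i ∷ j ∷ [])) (∉⇒All≢ r∉ ∷ un)
... | ((i≢j ∷ i≢r ∷ i∉R) ∷ (j≢r ∷ j∉R) ∷ r∉R ∷ uR) = resolution
  (((plus , i , minus , j) ∷ R) ∷ ((plus , j , minus , r) ∷ R) ∷ ((plus , j , plus , r) ∷ R) ∷ [])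
  ( isNF l ((i≢j ∷ i∉R) ∷ j∉R ∷ uR) ((refl , i<j) ∷ nf)
  ∷ isNF l ((j≢r ∷ j∉R) ∷ r∉R ∷ uR) ((refl , j<r) ∷ nf)
  ∷ isNF l ((j≢r ∷ j∉R) ∷ r∉R ∷ uR) ((refl , j<r) ∷ nf) ∷ [])
  (s≤s (s≤s z≤n))
  (λ p → identity (p i) (p j) (p r) (ev p R))
  where
  identity : ∀ x y z Q → (1ℤ ℤ.* x ℤ.+ 1ℤ ℤ.* y) ℤ.* Q
    ≡ (1ℤ ℤ.* x ℤ.+ ℤ.- 1ℤ ℤ.* y) ℤ.* Q
      ℤ.+ ((1ℤ ℤ.* y ℤ.+ ℤ.- 1ℤ ℤ.* z) ℤ.* Q ℤ.+ ((1ℤ ℤ.* y ℤ.+ 1ℤ ℤ.* z) ℤ.* Q ℤ.+ 0ℤ))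
  identity = ℤR.solve-∀

resolve : ∀ {n k} {F : List (Factor n)} → IsNF k F → Defective F → Resolution k F
resolve {F = F} nf (crossing d) with LM.find d
... | (s₁ , i , t , r) , f∈ , d′ with LM.find d′
...   | (s₂ , j , u , s) , g∈ , (i<j , j<r , r<s)
  with All.lookup (normal nf) f∈ | All.lookup (normal nf) g∈
...     | refl , _ | refl , _ with ∈-front₂ f∈ g∈ (λ { refl → FinP.<-irrefl refl i<j })
...       | R , σ = Resolution-↭ σ (resolve-crossing i<j j<r r<s (IsNF-↭ σ nf))
resolve {F = F} nf (nested d) with LM.find d
... | (s₁ , i , t , s) , f∈ , d′ with LM.find d′
...   | (s₂ , j , u , r) , g∈ , (refl , i<j , j<r , r<s)
  with All.lookup (normal nf) f∈ | All.lookup (normal nf) g∈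
...     | refl , _ | refl , _ with ∈-front₂ f∈ g∈ (λ { refl → FinP.<-irrefl refl i<j })
...       | R , σ = Resolution-↭ σ (resolve-nested i<j j<r r<s (IsNF-↭ σ nf))
resolve {F = F} nf (gapInside d) with LM.find d
... | (s₁ , i , t , r) , f∈ , (j , i<j , j<r , j∉) with All.lookup (normal nf) f∈ | ∈-front f∈
...   | refl , _ | R , σ = Resolution-↭ σ
  (resolve-gapInside i<j j<r (j∉ ∘ PermP.∈-resp-↭ (↭-sym (indices-↭ σ))) (IsNF-↭ σ nf))
resolve {F = F} nf (gapAfter d) with LM.find d
... | (s₁ , i , t , j) , f∈ , (refl , r , j<r , r∉) with All.lookup (normal nf) f∈ | ∈-front f∈
...   | refl , i<j | R , σ = Resolution-↭ σ
  (resolve-gapAfter i<j j<r (r∉ ∘ PermP.∈-resp-↭ (↭-sym (indices-↭ σ))) (IsNF-↭ σ nf))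

-- A positive decreasing point: every normal form is positive there, so its value, being
-- additive, strictly decreases from a normal form to each of at least two parts of it.
descending : ∀ n → Point n
descending n i = + (n ℕ.∸ toℕ i)

descending-pos : ∀ {n} (i : Fin n) → 0ℤ ℤ.< descending n i
descending-pos i = ℤ.+<+ (ℕP.m<n⇒0<n∸m (FinP.toℕ<n i))

descending-< : ∀ {n} {i j : Fin n} → i Fin.< j → descending n j ℤ.< descending n i
descending-< {n} {i} {j} i<j = ℤ.+<+ (ℕP.∸-monoʳ-< i<j (ℕP.<⇒≤ (FinP.toℕ<n j)))

*-pos : ∀ a b → 0ℤ ℤ.< a → 0ℤ ℤ.< b → 0ℤ ℤ.< a ℤ.* b
*-pos a b 0<a 0<b = subst (ℤ._< a ℤ.* b) (ℤP.*-zeroʳ a) (ℤP.*-monoˡ-<-pos a {{ℤ.positive 0<a}} 0<b)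

plusFactor-pos : ∀ x y → 0ℤ ℤ.< x → 0ℤ ℤ.< y → 0ℤ ℤ.< 1ℤ ℤ.* x ℤ.+ 1ℤ ℤ.* y
plusFactor-pos x y 0<x 0<y = subst₂ (λ a b → 0ℤ ℤ.< a ℤ.+ b)
  (sym (ℤP.*-identityˡ x)) (sym (ℤP.*-identityˡ y)) (ℤP.+-mono-< 0<x 0<y)

minusFactor-pos : ∀ x y → y ℤ.< x → 0ℤ ℤ.< 1ℤ ℤ.* x ℤ.+ ℤ.- 1ℤ ℤ.* y
minusFactor-pos x y y<x = subst₂ (λ a b → 0ℤ ℤ.< a ℤ.+ b)
  (sym (ℤP.*-identityˡ x)) (sym (ℤP.-1*i≡-i y))
  (subst (ℤ._< x ℤ.- y) (ℤP.+-inverseʳ y) (ℤP.+-monoˡ-< (ℤ.- y) y<x))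

ev-descending-pos : ∀ {n k} {F : List (Factor n)} → IsNF k F → 0ℤ ℤ.< ev (descending n) F
ev-descending-pos {n} nf = go (normal nf)
  where
  factor-pos : ∀ f → NormalFactor f → 0ℤ ℤ.< evF (descending n) f
  factor-pos (plus , i , plus , j) _ = plusFactor-pos (descending n i) (descending n j) (descending-pos i) (descending-pos j)
  factor-pos (plus , i , minus , j) (_ , i<j) = minusFactor-pos (descending n i) (descending n j) (descending-< i<j)
  go : ∀ {F} → All NormalFactor F → 0ℤ ℤ.< ev (descending n) F
  go [] = ℤ.+<+ (s≤s z≤n)
  go {f ∷ F} (nf₁ ∷ nf) = *-pos (evF (descending n) f) (ev (descending n) F) (factor-pos f nf₁) (go nf)

evs-nonneg : ∀ {n} {p : Point n} {Gs} → All (λ G → 0ℤ ℤ.< ev p G) Gs → 0ℤ ℤ.≤ evs p Gs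
evs-nonneg [] = ℤP.≤-refl
evs-nonneg (pos ∷ rest) = ℤP.+-mono-≤ (ℤP.<⇒≤ pos) (evs-nonneg rest)

ev≤evs : ∀ {n} {p : Point n} {Gs} → All (λ G → 0ℤ ℤ.< ev p G) Gs → All (λ G → ev p G ℤ.≤ evs p Gs) Gs
ev≤evs [] = []
ev≤evs {p = p} {G ∷ Gs} (pos ∷ rest) =
  subst (ℤ._≤ ev p G ℤ.+ evs p Gs) (ℤP.+-identityʳ (ev p G)) (ℤP.+-monoʳ-≤ (ev p G) (evs-nonneg rest))
  ∷ All.map (λ {H} le → ℤP.≤-trans le
      (subst (ℤ._≤ ev p G ℤ.+ evs p Gs) (ℤP.+-identityˡ (evs p Gs)) (ℤP.+-monoˡ-≤ (evs p Gs) (ℤP.<⇒≤ pos))))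
    (ev≤evs rest)

ev<evs : ∀ {n} {p : Point n} {Gs} → 2 ≤ length Gs → All (λ G → 0ℤ ℤ.< ev p G) Gs → All (λ G → ev p G ℤ.< evs p Gs) Gs
ev<evs {p = p} {G ∷ H ∷ Gs} (s≤s (s≤s z≤n)) (posG ∷ posH ∷ rest) =
  subst (ℤ._< ev p G ℤ.+ evs p (H ∷ Gs)) (ℤP.+-identityʳ (ev p G))
    (ℤP.+-monoʳ-< (ev p G) (ℤP.+-mono-<-≤ posH (evs-nonneg rest)))
  ∷ All.map (λ {K} le → ℤP.≤-<-trans le
      (subst (ℤ._< ev p G ℤ.+ evs p (H ∷ Gs)) (ℤP.+-identityˡ (evs p (H ∷ Gs))) (ℤP.+-monoˡ-< (evs p (H ∷ Gs)) posG)))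
    (ev≤evs (posH ∷ rest))

∣∣-mono-< : ∀ {a b} → 0ℤ ℤ.< a → a ℤ.< b → ℤ.∣ a ∣ ℕ.< ℤ.∣ b ∣
∣∣-mono-< (ℤ.+<+ _) (ℤ.+<+ a<b) = a<b

-- Decomposition into defect-free normal forms

Good : ∀ {n} → ℕ → List (Factor n) → Set
Good k F = IsNF k F × ¬ Defective F

-- `nonempty` lets `several` pass through the recursion: each of the at least two parts of the first
-- resolution contributes something. `several` later refutes a defect in a k-root that also has a
-- defect-free form.
record Decomposition {n} (k : ℕ) (F : List (Factor n)) : Set where
  constructor decomposition
  field
    parts : List (List (Factor n))
    allGood : All (Good k) parts
    nonempty : 1 ≤ length parts
    several : Defective F → 2 ≤ length parts
    expansion : ∀ p → ev p F ≡ evs p parts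

record SumDecomposition {n} (k : ℕ) (Fs : List (List (Factor n))) : Set where
  constructor sumDecomposition
  field
    parts : List (List (Factor n))
    allGood : All (Good k) parts
    longer : length Fs ≤ length parts
    expansion : ∀ p → evs p Fs ≡ evs p parts

combine : ∀ {n k} {Fs : List (List (Factor n))} → All (Decomposition k) Fs → SumDecomposition k Fs
combine [] = sumDecomposition [] [] z≤n (λ _ → refl)
combine (decomposition Gs good ne _ eq ∷ ds) with combine ds
... | sumDecomposition Hs good′ le eq′ = sumDecomposition (Gs ++ Hs) (AllP.++⁺ good good′)
  (subst (_ ≤_) (sym (ListP.length-++ Gs)) (ℕP.+-mono-≤ ne le))
  (λ p → trans (cong₂ ℤ._+_ (eq p) (eq′ p)) (sym (evs-++ p Gs Hs)))

decompose : ∀ {n k} {F : List (Factor n)} → IsNF k F → Decomposition k F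
decompose {n} {k} nf = go nf (ℕI.<-wellFounded _)
  where
  go : ∀ {F} → IsNF k F → Acc ℕ._<_ ℤ.∣ ev (descending n) F ∣ → Decomposition k F
  go {F} nf (acc rec) with defective? F
  ... | no ¬d = decomposition (F ∷ []) ((nf , ¬d) ∷ []) (s≤s z≤n) (λ d → contradiction d ¬d)
    (λ p → sym (ℤP.+-identityʳ (ev p F)))
  ... | yes d with resolve nf d
  ...   | resolution Gs nfs two≤ eq = decomposition (parts S) (allGood S)
    (ℕP.≤-trans (s≤s z≤n) two≤parts) (λ _ → two≤parts) (λ p → trans (eq p) (expansion S p))
    where
    open SumDecomposition
    smaller : ∀ {Hs} → All (IsNF k) Hs → All (λ H → ev (descending n) H ℤ.< ev (descending n) F) Hs → All (Decomposition k) Hs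
    smaller [] [] = []
    smaller (nf ∷ nfs) (lt ∷ lts) = go nf (rec (∣∣-mono-< (ev-descending-pos nf) lt)) ∷ smaller nfs lts
    S : SumDecomposition k Gs
    S = combine (smaller nfs (subst (λ z → All (λ H → ev (descending n) H ℤ.< z) Gs) (sym (eq (descending n)))
          (ev<evs two≤ (All.map ev-descending-pos nfs))))
    two≤parts : 2 ≤ length (parts S)
    two≤parts = ℕP.≤-trans two≤ (longer S)

-- Labels of normal forms

Closes : ∀ {n} → Fin n → Factor n → Set
Closes j (_ , _ , t , b) = t ≡ minus × b ≡ j

closes? : ∀ {n} (j : Fin n) F → Dec (Any (Closes j) F)
closes? j = Any.any? (λ { (_ , _ , t , b) → (t ≟S minus) ×-dec (b Fin.≟ j) })

letterOf : ∀ {P : Set} → Dec P → Letter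
letterOf (yes _) = two
letterOf (no _) = one

-- A computed counterpart of the relation `HasLabel`; `lab-spec` and `lab-determined` connect the
-- two.
lab : ∀ {n} → List (Factor n) → Vec Letter n
lab F = tabulate (λ j → letterOf (closes? j F))

lab-two : ∀ {n k} {F : List (Factor n)} {j} → IsNF k F → lookup (lab F) j ≡ two → ∃ λ i → (plus , i , minus , j) ∈F F
lab-two {F = F} {j} nf eq with closes? j F | trans (sym (VecP.lookup∘tabulate (λ j → letterOf (closes? j F)) j)) eq
... | yes c | _ with LM.find c
...   | (s , i , t , b) , f∈ , refl , refl with All.lookup (normal nf) f∈
...     | refl , _ = i , f∈
lab-two nf eq | no _ | ()

lab-closes : ∀ {n} {F : List (Factor n)} {s i j} → (s , i , minus , j) ∈F F → lookup (lab F) j ≡ two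
lab-closes {F = F} {j = j} f∈ = trans (VecP.lookup∘tabulate (λ j → letterOf (closes? j F)) j) go
  where
  go : letterOf (closes? j F) ≡ two
  go with closes? j F
  ... | yes _ = refl
  ... | no ¬c = contradiction (LM.lose f∈ (refl , refl)) ¬c

End : ∀ {n} → Factor n → Fin n → Set
End (_ , a , _ , b) x = x ≡ a ⊎ x ≡ b

End⇒∈ : ∀ {n} {F : List (Factor n)} {f x} → f ∈F F → End f x → x LM.∈ indices F
End⇒∈ f∈ (inj₁ refl) = indices-left f∈
End⇒∈ f∈ (inj₂ refl) = indices-right f∈

∈⇒End : ∀ {n} {F : List (Factor n)} {x} → x LM.∈ indices F → ∃ λ f → f ∈F F × End f x
∈⇒End {F = f ∷ F} (here refl) = f , here refl , inj₁ refl
∈⇒End {F = f ∷ F} (there (here refl)) = f , here refl , inj₂ refl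
∈⇒End {F = f ∷ F} (there (there x∈)) with ∈⇒End x∈
... | g , g∈ , e = g , there g∈ , e

share : ∀ {n} {F : List (Factor n)} → Unique (indices F) → ∀ {f g x} → f ∈F F → g ∈F F → End f x → End g x → f ≡ g
share u (here refl) (here refl) _ _ = refl
share ((_ ∷ a∉) ∷ b∉ ∷ _) (here refl) (there g∈) (inj₁ refl) e = contradiction (End⇒∈ g∈ e) (All≢⇒∉ a∉)
share ((_ ∷ a∉) ∷ b∉ ∷ _) (here refl) (there g∈) (inj₂ refl) e = contradiction (End⇒∈ g∈ e) (All≢⇒∉ b∉)
share ((_ ∷ a∉) ∷ b∉ ∷ _) (there f∈) (here refl) e (inj₁ refl) = contradiction (End⇒∈ f∈ e) (All≢⇒∉ a∉)
share ((_ ∷ a∉) ∷ b∉ ∷ _) (there f∈) (here refl) e (inj₂ refl) = contradiction (End⇒∈ f∈ e) (All≢⇒∉ b∉)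
share (_ ∷ _ ∷ u) (there f∈) (there g∈) e e′ = share u f∈ g∈ e e′

normal-< : ∀ {n k} {F : List (Factor n)} → IsNF k F → ∀ {s i t j} → (s , i , t , j) ∈F F → i Fin.< j
normal-< nf f∈ = proj₂ (All.lookup (normal nf) f∈)

left≢right : ∀ {n k} {F : List (Factor n)} → IsNF k F → ∀ {s i t j s′ i′ t′} →
  (s , i , t , j) ∈F F → ¬ ((s′ , i′ , t′ , i) ∈F F)
left≢right nf f∈ g∈ with share (uniq nf) f∈ g∈ (inj₁ refl) (inj₂ refl)
... | refl = FinP.<-irrefl refl (normal-< nf f∈)

lab-left : ∀ {n k} {F : List (Factor n)} → IsNF k F → ∀ {s i t j} → (s , i , t , j) ∈F F → lookup (lab F) i ≡ one
lab-left {F = F} nf {i = i} f∈ with lookup (lab F) i in eq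
... | one = refl
... | two = contradiction (proj₂ (lab-two nf eq)) (left≢right nf f∈)

-- The lexicographic order of words

firstDiff : ∀ {A : Set} → ((a b : A) → Dec (a ≡ b)) → ∀ {n} (u w : Vec A n) →
  u ≡ w ⊎ Σ (Fin n) λ d → lookup u d ≢ lookup w d × (∀ s → s Fin.< d → lookup u s ≡ lookup w s)
firstDiff _≟_ [] [] = inj₁ refl
firstDiff _≟_ (a ∷ u) (b ∷ w) with a ≟ b
... | no a≢b = inj₂ (zero , a≢b , λ _ ())
... | yes refl with firstDiff _≟_ u w
...   | inj₁ refl = inj₁ refl
...   | inj₂ (d , ne , agree) = inj₂ (suc d , ne , λ { zero _ → refl ; (suc s) (s≤s s<d) → agree s s<d })

_≟L_ : (a b : Letter) → Dec (a ≡ b)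
one ≟L one = yes refl
one ≟L two = no λ ()
two ≟L one = no λ ()
two ≟L two = yes refl

_<lex_ : ∀ {n} → Vec Letter n → Vec Letter n → Set
_<lex_ {n} u w = Σ (Fin n) λ d → lookup u d ≡ one × lookup w d ≡ two × (∀ s → s Fin.< d → lookup u s ≡ lookup w s)

<lex-tri : ∀ {n} (u w : Vec Letter n) → u ≡ w ⊎ u <lex w ⊎ w <lex u
<lex-tri u w with firstDiff _≟L_ u w
... | inj₁ eq = inj₁ eq
... | inj₂ (d , ne , agree) with lookup u d in eq₁ | lookup w d in eq₂
...   | one | one = contradiction refl ne
...   | one | two = inj₂ (inj₁ (d , eq₁ , eq₂ , agree))
...   | two | one = inj₂ (inj₂ (d , eq₂ , eq₁ , λ s s<d → sym (agree s s<d)))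
...   | two | two = contradiction refl ne

<lex-asym : ∀ {n} (u w : Vec Letter n) → u <lex w → ¬ (w <lex u)
<lex-asym u w (d , u₁ , w₂ , agree) (e , w₁ , u₂ , agree′) with FinP.<-cmp d e
... | tri< d<e _ _ = case trans (sym w₂) (trans (agree′ d d<e) u₁) of λ ()
... | tri≈ _ refl _ = case trans (sym u₁) u₂ of λ ()
... | tri> _ _ e<d = case trans (sym w₁) (trans (sym (agree e e<d)) u₂) of λ ()

-- Recursion on the length: every word starting with `one` is settled before any word starting with
-- `two`.
<lex-rec : ∀ {n} (P : Vec Letter n → Set) → (∀ w → (∀ u → u <lex w → P u) → P w) → ∀ w → P w
<lex-rec {zero} P step [] = step [] (λ { _ (() , _) })
<lex-rec {suc n} P step = λ { (one ∷ w) → from-one w ; (two ∷ w) → from-two w }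
  where
  from-one : ∀ w → P (one ∷ w)
  from-one = <lex-rec (P ∘ (one ∷_)) λ w ih → step (one ∷ w) λ where
    (x ∷ u) (zero , _ , () , _)
    (one ∷ u) (suc d , u₁ , w₂ , agree) → ih u (d , u₁ , w₂ , λ s s<d → agree (suc s) (s≤s s<d))
    (two ∷ u) (suc d , _ , _ , agree) → case agree zero (s≤s z≤n) of λ ()
  from-two : ∀ w → P (two ∷ w)
  from-two = <lex-rec (P ∘ (two ∷_)) λ w ih → step (two ∷ w) λ where
    (one ∷ u) _ → from-one u
    (two ∷ u) (zero , () , _)
    (two ∷ u) (suc d , u₁ , w₂ , agree) → ih u (d , u₁ , w₂ , λ s s<d → agree (suc s) (s≤s s<d))

-- Triangularity

letterValue : Letter → ℤ
letterValue one = + 1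
letterValue two = + 2

wordPoint : ∀ {n} → Vec Letter n → Point n
wordPoint w j = letterValue (lookup w j)

ev-zero : ∀ {n} (p : Point n) {F f} → f ∈F F → evF p f ≡ 0ℤ → ev p F ≡ 0ℤ
ev-zero p {F = f ∷ F} (here refl) eq = cong (ℤ._* ev p F) eq
ev-zero p {F = g ∷ F} (there f∈) eq = trans (cong (evF p g ℤ.*_) (ev-zero p f∈ eq)) (ℤP.*-zeroʳ (evF p g))

ev-nonzero : ∀ {n} (p : Point n) {F} → All (λ f → evF p f ≢ 0ℤ) F → ev p F ≢ 0ℤ
ev-nonzero p [] ()
ev-nonzero p {f ∷ F} (ne ∷ nes) eq with ℤP.i*j≡0⇒i≡0∨j≡0 (evF p f) eq
... | inj₁ z = ne z
... | inj₂ z = ev-nonzero p nes z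

-- If w is below the label at the first difference d, then the factor x_i − x_d vanishes at
-- wordPoint w, because w agrees with the label at i.
ev-triangular : ∀ {n k} {F : List (Factor n)} → IsNF k F → ∀ w → ev (wordPoint w) F ≢ 0ℤ → lab F ≡ w ⊎ lab F <lex w
ev-triangular {F = F} nf w ne with <lex-tri (lab F) w
... | inj₁ eq = inj₁ eq
... | inj₂ (inj₁ lt) = inj₂ lt
... | inj₂ (inj₂ (d , w₁ , lab₂ , agree)) with lab-two nf lab₂
...   | i , f∈ = contradiction (ev-zero (wordPoint w) f∈ vanish) ne
  where
  vanish : evF (wordPoint w) (plus , i , minus , d) ≡ 0ℤ
  vanish rewrite agree i (normal-< nf f∈) | lab-left nf f∈ | w₁ = refl

-- An antisymmetric factor takes the value 1 - 2, because its left end has letter `one` and its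
-- right end letter `two`; a symmetric factor is a sum of two positive letter values.
ev-diagonal : ∀ {n k} {F : List (Factor n)} → IsNF k F → ev (wordPoint (lab F)) F ≢ 0ℤ
ev-diagonal {F = F} nf = ev-nonzero (wordPoint (lab F)) (All.tabulate λ {f} f∈ → nonzero f f∈)
  where
  p = wordPoint (lab F)
  nonzero : ∀ f → f ∈F F → evF p f ≢ 0ℤ
  nonzero (s , i , t , j) f∈ with proj₁ (All.lookup (normal nf) f∈)
  nonzero (_ , i , plus , j) f∈ | refl with lookup (lab F) i | lookup (lab F) j
  ... | one | one = λ ()
  ... | one | two = λ ()
  ... | two | one = λ ()
  ... | two | two = λ ()
  nonzero (_ , i , minus , j) f∈ | refl rewrite lab-left nf f∈ | lab-closes f∈ = λ ()

-- Defect-free normal forms are determined by their labels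

inside : ∀ {n k} {F : List (Factor n)} → Good k F → ∀ {i t j x} → (plus , i , t , j) ∈F F → i Fin.< x → x Fin.< j →
  ∃ λ a → ∃ λ b → (plus , a , minus , b) ∈F F × End (plus , a , minus , b) x × b Fin.< j
inside {F = F} (nf , ¬d) {i} {t} {j} {x} f∈ i<x x<j with Any.any? (x Fin.≟_) (indices F)
... | no unused = contradiction (gapInside (LM.lose f∈ (x , i<x , x<j , unused))) ¬d
... | yes used with ∈⇒End used
...   | (s , a , u , b) , g∈ , e with All.lookup (normal nf) g∈
...     | refl , a<b with e
inside {F = F} (nf , ¬d) {i} {t} {j} {x} f∈ i<x x<j | yes used | (s , a , u , b) , g∈ , e | refl , a<b | inj₁ refl with FinP.<-cmp b j
... | tri≈ _ refl _ = case share (uniq nf) f∈ g∈ (inj₂ refl) (inj₂ refl) of λ { refl → contradiction i<x (FinP.<-irrefl refl) }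
... | tri> _ _ j<b = contradiction (crossing (LM.lose f∈ (LM.lose g∈ (i<x , x<j , j<b)))) ¬d
... | tri< b<j _ _ with u
...   | plus = contradiction (nested (LM.lose f∈ (LM.lose g∈ (refl , i<x , a<b , b<j)))) ¬d
...   | minus = a , b , g∈ , inj₁ refl , b<j
inside {F = F} (nf , ¬d) {i} {t} {j} {x} f∈ i<x x<j | yes used | (s , a , u , b) , g∈ , e | refl , a<b | inj₂ refl with FinP.<-cmp a i
... | tri≈ _ refl _ = case share (uniq nf) f∈ g∈ (inj₁ refl) (inj₁ refl) of λ { refl → contradiction x<j (FinP.<-irrefl refl) }
... | tri< a<i _ _ = contradiction (crossing (LM.lose g∈ (LM.lose f∈ (a<i , i<x , x<j)))) ¬d
... | tri> _ _ i<a with u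
...   | plus = contradiction (nested (LM.lose f∈ (LM.lose g∈ (refl , i<a , a<b , x<j)))) ¬d
...   | minus = a , b , g∈ , inj₂ refl , x<j

-- If i < i′, then i′ lies inside the factor of F closing at j, so by `inside` it is an end of an
-- antisymmetric factor of F closing at some b < j. By the hypothesis for b, G has that factor too,
-- although i′ already belongs to the factor of G closing at j.
minus-left-≮ : ∀ {n k} {F G : List (Factor n)} → Good k F → Good k G → lab F ≡ lab G → ∀ {j} →
  (∀ {j′} → j′ Fin.< j → ∀ {i i′} → (plus , i , minus , j′) ∈F F → (plus , i′ , minus , j′) ∈F G → i ≡ i′) →
  ∀ {i i′} → (plus , i , minus , j) ∈F F → (plus , i′ , minus , j) ∈F G → ¬ (i Fin.< i′)
minus-left-≮ {F = F} {G} gF gG eq ih f∈ g∈ i<i′ with inside gF f∈ i<i′ (normal-< (proj₁ gG) g∈)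
... | a , b , h∈ , e , b<j with lab-two (proj₁ gG) (subst (λ w → lookup w b ≡ two) eq (lab-closes h∈))
...   | c , h′∈ with ih b<j h∈ h′∈ | e
...     | refl | inj₁ refl = case share (uniq (proj₁ gG)) g∈ h′∈ (inj₁ refl) (inj₁ refl) of λ { refl → FinP.<-irrefl refl b<j }
...     | refl | inj₂ refl = left≢right (proj₁ gG) g∈ h′∈

minus-left-unique : ∀ {n k} {F G : List (Factor n)} → Good k F → Good k G → lab F ≡ lab G →
  ∀ {j i i′} → (plus , i , minus , j) ∈F F → (plus , i′ , minus , j) ∈F G → i ≡ i′
minus-left-unique {n} {k} {F} {G} gF gG eq {j} = go j (FinI.<-wellFounded j)
  where
  go : ∀ j → Acc Fin._<_ j → ∀ {i i′} → (plus , i , minus , j) ∈F F → (plus , i′ , minus , j) ∈F G → i ≡ i′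
  go j (acc rec) {i} {i′} f∈ g∈ with FinP.<-cmp i i′
  ... | tri≈ _ i≡i′ _ = i≡i′
  ... | tri< i<i′ _ _ = contradiction i<i′ (minus-left-≮ gF gG eq (λ lt → go _ (rec lt)) f∈ g∈)
  ... | tri> _ _ i′<i = contradiction i′<i
    (minus-left-≮ gG gF (sym eq) (λ lt g∈ f∈ → sym (go _ (rec lt) f∈ g∈)) g∈ f∈)

minus-⊆ : ∀ {n k} {F G : List (Factor n)} → Good k F → Good k G → lab F ≡ lab G →
  ∀ {i j} → (plus , i , minus , j) ∈F F → (plus , i , minus , j) ∈F G
minus-⊆ {G = G} gF gG eq {i} {j} f∈ with lab-two (proj₁ gG) (subst (λ w → lookup w j ≡ two) eq (lab-closes f∈))
... | i′ , g∈ = subst (λ z → (plus , z , minus , j) ∈F G) (sym (minus-left-unique gF gG eq f∈ g∈)) g∈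

used-after-plus : ∀ {n k} {F : List (Factor n)} → Good k F → ∀ {i j x} → (plus , i , plus , j) ∈F F → i Fin.< x → x LM.∈ indices F
used-after-plus {F = F} (nf , ¬d) {i} {j} {x} f∈ i<x with Any.any? (x Fin.≟_) (indices F)
... | yes used = used
... | no unused with FinP.<-cmp x j
...   | tri< x<j _ _ = contradiction (gapInside (LM.lose f∈ (x , i<x , x<j , unused))) ¬d
...   | tri≈ _ refl _ = indices-right f∈
...   | tri> _ _ j<x = contradiction (gapAfter (LM.lose f∈ (refl , x , j<x , unused))) ¬d

InMinus InPlus : ∀ {n} → List (Factor n) → Fin n → Set
InMinus F x = ∃ λ a → ∃ λ b → (plus , a , minus , b) ∈F F × End (plus , a , minus , b) x
InPlus F x = ∃ λ a → ∃ λ b → (plus , a , plus , b) ∈F F × End (plus , a , plus , b) x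

used-split : ∀ {n k} {F : List (Factor n)} → IsNF k F → ∀ {x} → x LM.∈ indices F → InMinus F x ⊎ InPlus F x
used-split nf x∈ with ∈⇒End x∈
... | (s , a , t , b) , f∈ , e with All.lookup (normal nf) f∈
used-split nf x∈ | (_ , a , plus , b) , f∈ , e | refl , _ = inj₂ (a , b , f∈ , e)
used-split nf x∈ | (_ , a , minus , b) , f∈ , e | refl , _ = inj₁ (a , b , f∈ , e)

minus-plus-disjoint : ∀ {n k} {F : List (Factor n)} → IsNF k F → ∀ {x} → InMinus F x → ¬ InPlus F x
minus-plus-disjoint nf (a , b , f∈ , e) (c , d , g∈ , e′) = case share (uniq nf) f∈ g∈ e e′ of λ ()

module SameLabel {n k} {F G : List (Factor n)} (gF : Good k F) (gG : Good k G) (eq : lab F ≡ lab G) where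

  nfF = proj₁ gF
  nfG = proj₁ gG

  InMinus→ : ∀ {x} → InMinus F x → InMinus G x
  InMinus→ (a , b , f∈ , e) = a , b , minus-⊆ gF gG eq f∈ , e

  InMinus← : ∀ {x} → InMinus G x → InMinus F x
  InMinus← (a , b , g∈ , e) = a , b , minus-⊆ gG gF (sym eq) g∈ , e

  usedF-unusedG : ∀ {x y} → x LM.∈ indices F → Unused x G → Unused y F → y Fin.< x
  usedF-unusedG {x} {y} x∈ x∉ y∉ with used-split nfF x∈
  ... | inj₁ m with InMinus→ m
  ...   | a , b , g∈ , e = contradiction (End⇒∈ g∈ e) x∉
  usedF-unusedG {x} {y} x∈ x∉ y∉ | inj₂ (a , b , f∈ , e) with FinP.<-cmp y a
  ...   | tri< y<a _ _ = ℕP.<-≤-trans y<a (a≤x e)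
    where
    a≤x : End (plus , a , plus , b) x → a Fin.≤ x
    a≤x (inj₁ refl) = ℕP.≤-refl
    a≤x (inj₂ refl) = ℕP.<⇒≤ (normal-< nfF f∈)
  ...   | tri≈ _ refl _ = contradiction (indices-left f∈) y∉
  ...   | tri> _ _ a<y = contradiction (used-after-plus gF f∈ a<y) y∉

  -- Descending induction on j, which must lie in a symmetric factor of G. If j is the right end
  -- there, a left end other than i would place one of the two left ends inside the other factor,
  -- hence in an antisymmetric factor. If G has x_j + x_q, then q follows i and so lies in a
  -- symmetric factor of F with right end beyond j; by induction this factor is in G, and sharing q
  -- with x_j + x_q it makes some index both a left and a right end.
  plus-⊆ : (∀ {x} → x LM.∈ indices F → x LM.∈ indices G) → ∀ {i j} → (plus , i , plus , j) ∈F F → (plus , i , plus , j) ∈F G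
  plus-⊆ sub {i} {j} = go j (FinI.>-wellFounded j)
    where
    go : ∀ j → Acc Fin._>_ j → ∀ {i} → (plus , i , plus , j) ∈F F → (plus , i , plus , j) ∈F G
    go j (acc rec) {i} f∈ with used-split nfG (sub (indices-right f∈))
    ... | inj₁ m = contradiction (i , j , f∈ , inj₂ refl) (minus-plus-disjoint nfF (InMinus← m))
    ... | inj₂ (p , .j , g∈ , inj₂ refl) with FinP.<-cmp p i
    ...   | tri≈ _ refl _ = g∈
    ...   | tri< p<i _ _ with inside gG g∈ p<i (normal-< nfF f∈)
    ...     | a , b , h∈ , e , _ = contradiction (i , j , f∈ , inj₁ refl) (minus-plus-disjoint nfF (InMinus← (a , b , h∈ , e)))
    go j (acc rec) {i} f∈ | inj₂ (p , .j , g∈ , inj₂ refl) | tri> _ _ i<p with inside gF f∈ i<p (normal-< nfG g∈)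
    ...     | a , b , h∈ , e , _ = contradiction (p , j , g∈ , inj₁ refl) (minus-plus-disjoint nfG (InMinus→ (a , b , h∈ , e)))
    go j (acc rec) {i} f∈ | inj₂ (.j , q , g∈ , inj₁ refl)
      with used-split nfF (used-after-plus gF f∈ (FinP.<-trans (normal-< nfF f∈) (normal-< nfG g∈)))
    ...   | inj₁ m = contradiction (j , q , g∈ , inj₂ refl) (minus-plus-disjoint nfG (InMinus→ m))
    ...   | inj₂ (.q , q′ , h∈ , inj₁ refl) = contradiction g∈
      (left≢right nfG (go q′ (rec (FinP.<-trans (normal-< nfG g∈) (normal-< nfF h∈))) h∈))
    ...   | inj₂ (p′ , .q , h∈ , inj₂ refl) with share (uniq nfG) g∈ (go q (rec (normal-< nfG g∈)) h∈) (inj₂ refl) (inj₂ refl)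
    ...     | refl = contradiction f∈ (left≢right nfF h∈)

  factors-⊆ : (∀ {x} → x LM.∈ indices F → x LM.∈ indices G) → ∀ {f} → f ∈F F → f ∈F G
  factors-⊆ sub {s , i , t , j} f∈ with All.lookup (normal nfF) f∈
  factors-⊆ sub {_ , i , plus , j} f∈ | refl , _ = plus-⊆ sub f∈
  factors-⊆ sub {_ , i , minus , j} f∈ | refl , _ = minus-⊆ gF gG eq f∈

subset-perm : ∀ {A : Set} {xs ys : List A} → Unique xs → (∀ {x} → x LM.∈ xs → x LM.∈ ys) → ∃ λ zs → ys ↭ xs ++ zs
subset-perm {xs = []} {ys} u sub = ys , ↭-refl
subset-perm {xs = x ∷ xs} {ys} (x∉ ∷ u) sub with ∈-front (sub (here refl))
... | ys′ , σ with subset-perm u sub′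
  where
  sub′ : ∀ {y} → y LM.∈ xs → y LM.∈ ys′
  sub′ y∈ with PermP.∈-resp-↭ σ (sub (there y∈))
  ... | here refl = contradiction y∈ (AllP.All¬⇒¬Any x∉)
  ... | there y∈′ = y∈′
...   | zs , τ = zs , ↭-trans σ (prep x τ)

subset-length : ∀ {A : Set} {xs ys : List A} → Unique xs → (∀ {x} → x LM.∈ xs → x LM.∈ ys) → length xs ≤ length ys
subset-length {xs = xs} u sub with subset-perm u sub
... | zs , σ = subst (length xs ≤_) (sym (trans (PermP.↭-length σ) (ListP.length-++ xs))) (ℕP.m≤m+n (length xs) (length zs))

subset-↭ : ∀ {A : Set} {xs ys : List A} → Unique xs → (∀ {x} → x LM.∈ xs → x LM.∈ ys) → length xs ≡ length ys → xs ↭ ys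
subset-↭ {xs = xs} {ys} u sub eq with subset-perm u sub
... | [] , σ = ↭-sym (subst (ys ↭_) (ListP.++-identityʳ xs) σ)
... | z ∷ zs , σ = contradiction
  (ℕP.+-cancelˡ-≡ (length xs) 0 _ (trans (ℕP.+-identityʳ _) (trans eq (trans (PermP.↭-length σ) (ListP.length-++ xs)))))
  λ ()

factors-unique : ∀ {n} {F : List (Factor n)} → Unique (indices F) → Unique F
factors-unique {F = []} u = []
factors-unique {F = f ∷ F} ((_ ∷ a∉) ∷ _ ∷ u) = All.tabulate (λ { g∈ refl → All≢⇒∉ a∉ (indices-left g∈) }) ∷ factors-unique u

-- The indices outside the antisymmetric factors that a defect-free normal form uses are the
-- last ones, so of two such sets one contains the other.
sameLabel-↭ : ∀ {n k} {F G : List (Factor n)} → Good k F → Good k G → lab F ≡ lab G → F ↭ G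
sameLabel-↭ {n} {k} {F} {G} gF gG eq
  with FinP.any? (λ x → Any.any? (x Fin.≟_) (indices F) ×-dec unused? x G)
... | no none = subset-↭ (factors-unique (uniq nfF)) (factors-⊆ used⊆) (trans (len nfF) (sym (len nfG)))
  where
  open SameLabel gF gG eq
  used⊆ : ∀ {x} → x LM.∈ indices F → x LM.∈ indices G
  used⊆ {x} x∈ with Any.any? (x Fin.≟_) (indices G)
  ... | yes x∈G = x∈G
  ... | no x∉G = contradiction (x , x∈ , x∉G) none
... | yes (x , x∈F , x∉G) = ↭-sym (subset-↭ (factors-unique (uniq nfF)) (factors-⊆ used⊆) (trans (len nfF) (sym (len nfG))))
  where
  open SameLabel gG gF (sym eq)
  used⊆ : ∀ {y} → y LM.∈ indices G → y LM.∈ indices F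
  used⊆ {y} y∈ with Any.any? (y Fin.≟_) (indices F)
  ... | yes y∈F = y∈F
  ... | no y∉F = contradiction (SameLabel.usedF-unusedG gF gG eq x∈F x∉G y∉F) (ℕP.<-asym (usedF-unusedG y∈ y∉F x∉G))

-- Linear independence of the defect-free normal forms

_≟W_ : ∀ {n} (u w : Vec Letter n) → Dec (u ≡ w)
_≟W_ = VecP.≡-dec _≟L_

Comb : ℕ → Set
Comb n = List (ℚ × List (Factor n))

comb : ∀ {n} → Point n → Comb n → ℚ
comb p [] = 0ℚ
comb p ((c , F) ∷ K) = c ℚ.* ι (ev p F) ℚ.+ comb p K

comb-++ : ∀ {n} (p : Point n) K K′ → comb p (K ++ K′) ≡ comb p K ℚ.+ comb p K′
comb-++ p [] K′ = sym (ℚP.+-identityˡ _)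
comb-++ p ((c , F) ∷ K) K′ = trans (cong (c ℚ.* ι (ev p F) ℚ.+_) (comb-++ p K K′))
  (sym (ℚP.+-assoc (c ℚ.* ι (ev p F)) (comb p K) (comb p K′)))

-- A combination may list one root several times, so independence concerns the total coefficient at
-- each label.
labelSum : ∀ {n} → Vec Letter n → Comb n → ℚ
labelSum w [] = 0ℚ
labelSum w ((c , F) ∷ K) = c ℚ.* 𝟙 (lab F ≟W w) ℚ.+ labelSum w K

*-cancel-zero : ∀ {a b} → a ℚ.* b ≡ 0ℚ → b ≢ 0ℚ → a ≡ 0ℚ
*-cancel-zero {a} {b} ab≡0 b≢0 = begin
  a                       ≡⟨ ℚP.*-identityʳ a ⟨
  a ℚ.* 1ℚ                ≡⟨ cong (a ℚ.*_) (ℚP.*-inverseʳ b) ⟨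
  a ℚ.* (b ℚ.* ℚ.1/ b)    ≡⟨ ℚP.*-assoc a b (ℚ.1/ b) ⟨
  a ℚ.* b ℚ.* ℚ.1/ b      ≡⟨ cong (ℚ._* ℚ.1/ b) ab≡0 ⟩
  0ℚ ℚ.* ℚ.1/ b           ≡⟨ ℚP.*-zeroˡ (ℚ.1/ b) ⟩
  0ℚ ∎
  where
  open ≡-Reasoning
  instance _ = ℚ.≢-nonZero b≢0

-- The common value at p of the members of K with label u, and 0 if there are none.
evOfLabel : ∀ {n} → Point n → Comb n → Vec Letter n → ℚ
evOfLabel p [] u = 0ℚ
evOfLabel p ((c , F) ∷ K) u with lab F ≟W u
... | yes _ = ι (ev p F)
... | no _ = evOfLabel p K u

GoodComb : ∀ {n} → ℕ → Comb n → Set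
GoodComb k = All (Good k ∘ proj₂)

-- Members with equal labels are permutations of each other, so the first one found speaks for all.
evOfLabel-∈ : ∀ {n k} (p : Point n) {K : Comb n} → GoodComb k K → ∀ {c F} → (c , F) LM.∈ K → evOfLabel p K (lab F) ≡ ι (ev p F)
evOfLabel-∈ p {(d , G) ∷ K} good@(gG ∷ gK) {c} {F} m with lab G ≟W lab F
... | yes eq = cong ι (ev-↭ p (sameLabel-↭ gG (All.lookup good m) eq))
... | no ne with m
...   | here refl = contradiction refl ne
...   | there m′ = evOfLabel-∈ p gK m′

evOfLabel-zero : ∀ {n} (p : Point n) K u → All (λ cF → lab (proj₂ cF) ≡ u → ev p (proj₂ cF) ≡ 0ℤ) K → evOfLabel p K u ≡ 0ℚ
evOfLabel-zero p [] u [] = refl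
evOfLabel-zero p ((c , F) ∷ K) u (z ∷ zs) with lab F ≟W u
... | yes eq = cong ι (z eq)
... | no _ = evOfLabel-zero p K u zs

comb-labelSum : ∀ {n} (p : Point n) (φ : Vec Letter n → ℚ) K → All (λ cF → φ (lab (proj₂ cF)) ≡ ι (ev p (proj₂ cF))) K →
  comb p K ≡ WordSum.sumV n (λ u → labelSum u K ℚ.* φ u)
comb-labelSum {n} p φ [] [] = sym (WordSum.sumV-zero n (λ u → ℚP.*-zeroˡ (φ u)))
comb-labelSum {n} p φ ((c , F) ∷ K) (eq ∷ eqs) = sym (begin
  sumV n (λ u → (c ℚ.* 𝟙 (lab F ≟W u) ℚ.+ labelSum u K) ℚ.* φ u)
    ≡⟨ sumV-cong n (λ u → solve 4 (λ c d r m → (c :* d :+ r) :* m := c :* (d :* m) :+ r :* m) refl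
         c (𝟙 (lab F ≟W u)) (labelSum u K) (φ u)) ⟩
  sumV n (λ u → c ℚ.* (𝟙 (lab F ≟W u) ℚ.* φ u) ℚ.+ labelSum u K ℚ.* φ u)
    ≡⟨ sumV-linear n c (λ u → 𝟙 (lab F ≟W u) ℚ.* φ u) (λ u → labelSum u K ℚ.* φ u) ⟩
  c ℚ.* sumV n (λ u → 𝟙 (lab F ≟W u) ℚ.* φ u) ℚ.+ sumV n (λ u → labelSum u K ℚ.* φ u)
    ≡⟨ cong₂ (λ x y → c ℚ.* x ℚ.+ y)
         (trans (sumV-single n _ (lab F) (λ u ne → trans (cong (ℚ._* φ u) (𝟙-no {d = lab F ≟W u} (ne ∘ sym))) (ℚP.*-zeroˡ (φ u))))
           (trans (cong (ℚ._* φ (lab F)) (𝟙-yes {d = lab F ≟W lab F} refl)) (trans (ℚP.*-identityˡ _) eq)))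
         (sym (comb-labelSum p φ K eqs)) ⟩
  c ℚ.* ι (ev p F) ℚ.+ comb p K ∎)
  where
  open ≡-Reasoning
  open +-*-Solver
  open WordSum

-- The default 0 of `evOfLabel` is unambiguous at `wordPoint w`: by `ev-diagonal` no member with
-- label w vanishes there, so the value 0 means that there is none.
labelSum-absent : ∀ {n k} w (K : Comb n) → GoodComb k K → evOfLabel (wordPoint w) K w ≡ 0ℚ → labelSum w K ≡ 0ℚ
labelSum-absent w [] [] z = refl
labelSum-absent w ((c , F) ∷ K) ((nf , _) ∷ gK) z with lab F ≟W w
... | yes refl = contradiction (ι-injective {b = 0ℤ} z) (ev-diagonal nf)
... | no _ = trans (cong₂ ℚ._+_ (ℚP.*-zeroʳ c) (labelSum-absent w K gK z)) (ℚP.+-identityˡ 0ℚ)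

-- At `wordPoint w` only the label w survives: smaller labels have total coefficient 0 by induction,
-- and members with larger labels vanish by `ev-triangular`.
labelSum-zero : ∀ {n k} (K : Comb n) → GoodComb k K → (∀ p → comb p K ≡ 0ℚ) → ∀ w → labelSum w K ≡ 0ℚ
labelSum-zero {n} K good vanish = <lex-rec (λ w → labelSum w K ≡ 0ℚ) step
  where
  step : ∀ w → (∀ u → u <lex w → labelSum u K ≡ 0ℚ) → labelSum w K ≡ 0ℚ
  step w ih = finish (evOfLabel p K w ℚ.≟ 0ℚ)
    where
    p = wordPoint w
    φ = evOfLabel p K
    above : ∀ {u} → w <lex u → φ u ≡ 0ℚ
    above {u} w<u = evOfLabel-zero p K u (All.map (λ {cF} (nf , _) eq → zero-at {proj₂ cF} nf eq) good)
      where
      zero-at : ∀ {F} → IsNF _ F → lab F ≡ u → ev p F ≡ 0ℤ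
      zero-at {F} nf refl with ev p F ℤ.≟ 0ℤ
      ... | yes z = z
      ... | no ne with ev-triangular nf w ne
      ...   | inj₁ refl = contradiction w<u (<lex-asym (lab F) (lab F) w<u)
      ...   | inj₂ lt = contradiction w<u (<lex-asym (lab F) w lt)
    off : ∀ u → u ≢ w → labelSum u K ℚ.* φ u ≡ 0ℚ
    off u u≢w with <lex-tri u w
    ... | inj₁ eq = contradiction eq u≢w
    ... | inj₂ (inj₁ u<w) = trans (cong (ℚ._* φ u) (ih u u<w)) (ℚP.*-zeroˡ (φ u))
    ... | inj₂ (inj₂ w<u) = trans (cong (labelSum u K ℚ.*_) (above w<u)) (ℚP.*-zeroʳ (labelSum u K))
    product-zero : labelSum w K ℚ.* φ w ≡ 0ℚ
    product-zero = trans (sym (WordSum.sumV-single n (λ u → labelSum u K ℚ.* φ u) w off))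
      (trans (sym (comb-labelSum p φ K (All.tabulate (evOfLabel-∈ p good)))) (vanish p))
    finish : Dec (φ w ≡ 0ℚ) → labelSum w K ≡ 0ℚ
    finish (yes z) = labelSum-absent w K good z
    finish (no nz) = *-cancel-zero product-zero nz

-- Positive combinations equal to a defect-free normal form

PositiveComb : ∀ {n} → Comb n → Set
PositiveComb = All (λ cF → 0ℚ ℚ.< proj₁ cF)

weight-nonneg : ∀ {P : Set} {c} → 0ℚ ℚ.< c → (d : Dec P) → 0ℚ ℚ.≤ c ℚ.* 𝟙 d
weight-nonneg {c = c} 0<c (yes _) = ℚP.<⇒≤ (subst (0ℚ ℚ.<_) (sym (ℚP.*-identityʳ c)) 0<c)
weight-nonneg {c = c} 0<c (no _) = ℚP.≤-reflexive (sym (ℚP.*-zeroʳ c))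

labelSum-nonneg : ∀ {n} w {K : Comb n} → PositiveComb K → 0ℚ ℚ.≤ labelSum w K
labelSum-nonneg w [] = ℚP.≤-refl
labelSum-nonneg w {(c , F) ∷ K} (pos ∷ rest) = ℚP.+-mono-≤ (weight-nonneg pos (lab F ≟W w)) (labelSum-nonneg w rest)

labelSum-pos : ∀ {n} {K : Comb n} → PositiveComb K → ∀ {c F} → (c , F) LM.∈ K → 0ℚ ℚ.< labelSum (lab F) K
labelSum-pos {K = (c , F) ∷ K} (pos ∷ rest) (here refl) = ℚP.+-mono-<-≤
  (subst (0ℚ ℚ.<_) (sym (trans (cong (c ℚ.*_) (𝟙-yes {d = lab F ≟W lab F} refl)) (ℚP.*-identityʳ c))) pos)
  (labelSum-nonneg (lab F) rest)
labelSum-pos {K = (d , G) ∷ K} (pos ∷ rest) {F = F} (there m) =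
  ℚP.+-mono-≤-< (weight-nonneg pos (lab G ≟W lab F)) (labelSum-pos rest m)

-- Move G to the other side with coefficient -1. At a label other than that of G only positive
-- coefficients are collected, so a member with that label would make the sum positive, against
-- independence.
rigidity : ∀ {n k} {G : List (Factor n)} {K} → Good k G → GoodComb k K → PositiveComb K →
  (∀ p → ι (ev p G) ≡ comb p K) → All (λ cF → lab (proj₂ cF) ≡ lab G) K
rigidity {n} {k} {G} {K} gG gK pos eq = All.tabulate (λ {cF} → go cF)
  where
  K′ : Comb n
  K′ = (ℚ.- 1ℚ , G) ∷ K
  vanish : ∀ p → comb p K′ ≡ 0ℚ
  vanish p = trans (cong (ℚ.- 1ℚ ℚ.* ι (ev p G) ℚ.+_) (sym (eq p)))
    (solve 1 (λ x → (:- con 1ℚ) :* x :+ x := con 0ℚ) refl (ι (ev p G)))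
    where open +-*-Solver
  go : ∀ cF → cF LM.∈ K → lab (proj₂ cF) ≡ lab G
  go (c , F) m with lab F ≟W lab G
  ... | yes e = e
  ... | no ne = contradiction (labelSum-pos pos m) (ℚP.<-irrefl (sym (begin
      labelSum (lab F) K   ≡⟨ ℚP.+-identityˡ _ ⟨
      0ℚ ℚ.+ labelSum (lab F) K ≡⟨ cong (λ z → ℚ.- 1ℚ ℚ.* z ℚ.+ labelSum (lab F) K) (𝟙-no {d = lab G ≟W lab F} (ne ∘ sym)) ⟨
      labelSum (lab F) K′  ≡⟨ labelSum-zero K′ (gG ∷ gK) vanish (lab F) ⟩
      0ℚ ∎)))
    where open ≡-Reasoning

-- The leading monomial

leftSet : ∀ {n} → List (Factor n) → Subset n
leftSet [] = ⊥
leftSet ((_ , a , _ , _) ∷ F) = ⁅ a ⁆ ∪ leftSet F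

∈-leftSet : ∀ {n} {F : List (Factor n)} {x} → x ∈ leftSet F → ∃ λ s → ∃ λ t → ∃ λ b → (s , x , t , b) ∈F F
∈-leftSet {F = []} x∈ = contradiction x∈ SubP.∉⊥
∈-leftSet {F = (s , a , t , b) ∷ F} x∈ with ∈-insert x∈
... | inj₁ refl = s , t , b , here refl
... | inj₂ x∈′ with ∈-leftSet {F = F} x∈′
...   | s′ , t′ , b′ , m = s′ , t′ , b′ , there m

leftSet-∈ : ∀ {n} {F : List (Factor n)} {s a t b} → (s , a , t , b) ∈F F → a ∈ leftSet F
leftSet-∈ {a = a} (here refl) = SubP.p⊆p∪q _ (SubP.x∈⁅x⁆ a)
leftSet-∈ {F = (_ , c , _ , _) ∷ _} (there m) = SubP.q⊆p∪q ⁅ c ⁆ _ (leftSet-∈ m)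

∣leftSet∣ : ∀ {n} (F : List (Factor n)) → Unique (indices F) → ∣ leftSet F ∣ ≡ length F
∣leftSet∣ {n} [] u = SubP.∣⊥∣≡0 n
∣leftSet∣ ((s , a , t , b) ∷ F) ((_ ∷ a∉) ∷ _ ∷ u) = trans
  (∣insert∣ a (leftSet F) (λ a∈ → let _ , _ , _ , m = ∈-leftSet {F = F} a∈ in All≢⇒∉ a∉ (indices-left m)))
  (cong suc (∣leftSet∣ F u))

ind-∈ : ∀ {n} {I : Subset n} {x} → x ∈ I → ind I x ≡ 1ℤ
ind-∈ x∈ = cong (if_then 1ℤ else 0ℤ) (VecP.[]=⇒lookup x∈)

ind-∉ : ∀ {n} {I : Subset n} {x} → x ∉ I → ind I x ≡ 0ℤ
ind-∉ {I = I} {x} x∉ with lookup I x in eq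
... | true = contradiction (VecP.lookup⇒[]= x I eq) x∉
... | false = refl

leftPoint : ∀ {n} → List (Factor n) → Point n
leftPoint F = ind (leftSet F)

ev-one : ∀ {n} (p : Point n) {F} → All (λ f → evF p f ≡ 1ℤ) F → ev p F ≡ 1ℤ
ev-one p [] = refl
ev-one p (eq ∷ eqs) = cong₂ ℤ._*_ eq (ev-one p eqs)

-- Every factor has its left end, with sign `plus`, in the set and its right end outside. The value
-- is the coefficient of the leading monomial.
ev-leftPoint : ∀ {n k} {F : List (Factor n)} → IsNF k F → ev (leftPoint F) F ≡ 1ℤ
ev-leftPoint {F = F} nf = ev-one (leftPoint F) (All.tabulate (λ {f} f∈ → one-at f f∈))
  where
  one-at : ∀ f → f ∈F F → evF (leftPoint F) f ≡ 1ℤ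
  one-at (s , a , t , b) f∈ with proj₁ (All.lookup (normal nf) f∈)
  ... | refl = trans
    (cong₂ (λ x y → 1ℤ ℤ.* x ℤ.+ sgnℤ t ℤ.* y) (ind-∈ (leftSet-∈ f∈))
      (ind-∉ {I = leftSet F} {b} (λ b∈ → let _ , _ , _ , m = ∈-leftSet {F = F} b∈ in left≢right nf m f∈)))
    (cong (λ z → 1ℤ ℤ.+ z) (ℤP.*-zeroʳ (sgnℤ t)))

evs-const : ∀ {n} (p : Point n) {Hs z} → All (λ H → ev p H ≡ z) Hs → evs p Hs ≡ + length Hs ℤ.* z
evs-const p {z = z} [] = sym (ℤP.*-zeroˡ z)
evs-const p {H ∷ Hs} {z} (eq ∷ eqs) = trans (cong₂ ℤ._+_ eq (evs-const p eqs)) (sym (ℤP.suc-* (+ length Hs) z))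

-- A normal form has a coefficient 1, so it is not a proper multiple of another one.
multiple-one : ∀ {n k} {F : List (Factor n)} → IsNF k F → ∀ N {z} → ev (leftPoint F) F ≡ + N ℤ.* z → N ≡ 1
multiple-one {F = F} nf N {z} eq = ℕP.m*n≡1⇒m≡1 N ℤ.∣ z ∣
  (trans (sym (ℤP.abs-* (+ N) z)) (cong ℤ.∣_∣ (trans (sym eq) (ev-leftPoint nf))))

-- All parts are permutations of G, so F is N times G with N = `length Hs`, and the coefficient 1 of
-- F forces N = 1.
sameLabel-parts : ∀ {n k} {F G : List (Factor n)} → IsNF k F → Good k G → ∀ {Hs} → All (Good k) Hs →
  All (λ H → lab H ≡ lab G) Hs → (∀ p → ev p F ≡ evs p Hs) → length Hs ≡ 1 × (∀ p → ev p F ≡ ev p G)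
sameLabel-parts {F = F} {G} nf gG {Hs} good labs eq = single , λ p → begin
  ev p F                     ≡⟨ multiple p ⟩
  + length Hs ℤ.* ev p G     ≡⟨ cong (λ N → + N ℤ.* ev p G) single ⟩
  1ℤ ℤ.* ev p G              ≡⟨ ℤP.*-identityˡ _ ⟩
  ev p G ∎
  where
  open ≡-Reasoning
  multiple : ∀ p → ev p F ≡ + length Hs ℤ.* ev p G
  multiple p = trans (eq p) (evs-const p (All.map (λ (gH , l) → ev-↭ p (sameLabel-↭ gH gG l)) (All.zip (good , labs))))
  single : length Hs ≡ 1
  single = multiple-one nf (length Hs) (multiple (leftPoint F))

-- Normal forms and k-roots

polyNF : ∀ {n k} → NF n k → V n k
polyNF f = poly (proj₁ (proj₁ f))

facs-IsNF : ∀ {n k} (f : NF n k) → IsNF k (facs f)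
facs-IsNF ((fs , u) , nf) = isNF (VecP.length-toList fs) u nf

toNF : ∀ {n k} {F : List (Factor n)} → IsNF k F → Σ (NF n k) λ f → facs f ≡ F
toNF {F = F} (isNF refl u nf) =
  ((Vec.fromList F , subst (Unique ∘ indices) (sym eq) u) , subst (All NormalFactor) (sym eq) nf) , eq
  where eq = VecP.toList∘fromList F

Defect⇒Defective : ∀ {n k} {f : NF n k} → Defect f → Defective (facs f)
Defect⇒Defective (defect-i i j r s t t′ i<j j<r r<s m m′) = crossing (LM.lose m (LM.lose m′ (i<j , j<r , r<s)))
Defect⇒Defective (defect-ii i j r s t i<j j<r r<s m m′) = nested (LM.lose m (LM.lose m′ (refl , i<j , j<r , r<s)))
Defect⇒Defective (defect-iii i j r t i<j j<r m unused) = gapInside (LM.lose m (j , i<j , j<r , unused))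
Defect⇒Defective (defect-iv i j r i<j j<r m unused) = gapAfter (LM.lose m (refl , r , j<r , unused))

Defective⇒Defect : ∀ {n k} {f : NF n k} → Defective (facs f) → Defect f
Defective⇒Defect {f = f} (crossing d) with LM.find d
... | (_ , i , t , r) , m , d′ with LM.find d′
...   | (_ , j , t′ , s) , m′ , (i<j , j<r , r<s) with All.lookup (proj₂ f) m | All.lookup (proj₂ f) m′
...     | refl , _ | refl , _ = defect-i i j r s t t′ i<j j<r r<s m m′
Defective⇒Defect {f = f} (nested d) with LM.find d
... | (_ , i , t , s) , m , d′ with LM.find d′
...   | (_ , j , _ , r) , m′ , (refl , i<j , j<r , r<s) with All.lookup (proj₂ f) m | All.lookup (proj₂ f) m′
...     | refl , _ | refl , _ = defect-ii i j r s t i<j j<r r<s m m′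
Defective⇒Defect {f = f} (gapInside d) with LM.find d
... | (_ , i , t , r) , m , (j , i<j , j<r , unused) with All.lookup (proj₂ f) m
...   | refl , _ = defect-iii i j r t i<j j<r m unused
Defective⇒Defect {f = f} (gapAfter d) with LM.find d
... | (_ , i , _ , j) , m , (refl , r , j<r , unused) with All.lookup (proj₂ f) m
...   | refl , i<j = defect-iv i j r i<j j<r m unused

polyNF-ev : ∀ {n k} (f : NF n k) I → polyNF f I ≡ ι (ev (ind (proj₁ I)) (facs f))
polyNF-ev ((fs , u) , _) = poly-ev fs u

E-NF : ∀ {n k} {f : NF n k} {α} → IsNormalFormOf f α → ∀ p → E p α ≡ ι (ev p (facs f))
E-NF {f = ((fs , u) , _)} f≈α p = trans (sym (E-cong p f≈α)) (E-poly p fs u)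

ev-equal : ∀ {n k} {f g : NF n k} {α} → IsNormalFormOf f α → IsNormalFormOf g α → ∀ p → ev p (facs f) ≡ ev p (facs g)
ev-equal {f = f} {g} f≈α g≈α p = ι-injective (trans (sym (E-NF {f = f} f≈α p)) (E-NF {f = g} g≈α p))

≈V-from-ev : ∀ {n k} {f g : NF n k} {α β} → IsNormalFormOf f α → IsNormalFormOf g β →
  (∀ p → ev p (facs f) ≡ ev p (facs g)) → α ≈V β
≈V-from-ev {f = f} {g} f≈α g≈β eq I = trans (sym (f≈α I))
  (trans (polyNF-ev f I) (trans (cong ι (eq (ind (proj₁ I)))) (trans (sym (polyNF-ev g I)) (g≈β I))))

≢⇒∉-∈ : ∀ {n} {S I : Subset n} {d} → lookup S d ≢ lookup I d → (d ∈ S × d ∉ I) ⊎ (d ∈ I × d ∉ S)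
≢⇒∉-∈ {S = S} {I} {d} ne with lookup S d in eqS | lookup I d in eqI
... | true | true = contradiction refl ne
... | true | false = inj₁ (VecP.lookup⇒[]= d S eqS , λ d∈ → case trans (sym eqI) (VecP.[]=⇒lookup d∈) of λ ())
... | false | true = inj₂ (VecP.lookup⇒[]= d I eqI , λ d∈ → case trans (sym eqS) (VecP.[]=⇒lookup d∈) of λ ())
... | false | false = contradiction refl ne

transport-∈ : ∀ {n} {S I : Subset n} {x} → lookup S x ≡ lookup I x → x ∈ S → x ∈ I
transport-∈ {I = I} {x} eq x∈ = VecP.lookup⇒[]= x I (trans (sym eq) (VecP.[]=⇒lookup x∈))

≺-tri : ∀ {n} (S I : Subset n) → S ≡ I ⊎ S ≺ I ⊎ I ≺ S
≺-tri S I with firstDiff _≟B_ S I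
... | inj₁ eq = inj₁ eq
... | inj₂ (d , ne , agree) with ≢⇒∉-∈ {S = S} {I} ne
...   | inj₁ (d∈S , d∉I) = inj₂ (inj₁ (d , d∈S , d∉I ,
  λ s s<d → transport-∈ {S = S} {I} (agree s s<d) , transport-∈ {S = I} {S} (sym (agree s s<d))))
...   | inj₂ (d∈I , d∉S) = inj₂ (inj₂ (d , d∈I , d∉S ,
  λ s s<d → transport-∈ {S = I} {S} (sym (agree s s<d)) , transport-∈ {S = S} {I} (agree s s<d)))

-- If S precedes leftSet F, its first new element is the right end of a factor whose left end
-- is in S as well.
TermOf-⊀ : ∀ {n k} {F : List (Factor n)} → IsNF k F → ∀ {S} → TermOf F S → ¬ (S ≺ leftSet F)
TermOf-⊀ {F = F} nf (_ , sub , sep) (t , t∈S , t∉L , agree) with ∈⇒End (sub t∈S)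
... | (s , a , u , b) , f∈ , inj₁ refl = t∉L (leftSet-∈ f∈)
... | (s , a , u , b) , f∈ , inj₂ refl = All.lookup sep f∈ (proj₂ (agree a (normal-< nf f∈)) (leftSet-∈ f∈) , t∈S)

positive-NF : ∀ {n k} (f : NF n k) → Positive (polyNF f)
positive-NF {n} {k} f@((fs , u) , _) = I ,
  subst (0ℚ ℚ.<_) (sym (trans (polyNF-ev f I) (cong ι (ev-leftPoint nf)))) 0<1 ,
  λ J J≺I → coeffAt-zero (proj₁ J) (terms (facs f))
    (All.map (λ { ok refl → TermOf-⊀ nf ok J≺I }) (terms-TermOf (facs f) u))
  where
  nf = facs-IsNF f
  I : KSet n k
  I = leftSet (facs f) , trans (∣leftSet∣ (facs f) u) (len nf)

Positive-cong : ∀ {n k} {u v : V n k} → u ≈V v → Positive u → Positive v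
Positive-cong eq (I , pos , before) = I , subst (0ℚ ℚ.<_) (eq I) pos , λ J J≺I → trans (sym (eq J)) (before J J≺I)

NF-posRoot : ∀ {n k} {f : NF n k} {α} → IsNormalFormOf f α → PosRoot α
NF-posRoot {f = f} f≈α = (proj₁ f , f≈α) , Positive-cong f≈α (positive-NF f)

-- Compare the leading monomials of u and v. If they coincide, both coefficients there are positive;
-- otherwise, at the earlier one, one of the vectors is positive and the other 0.
Positive-asym : ∀ {n k} {u v : V n k} → (∀ I → v I ≡ ℚ.- u I) → Positive u → ¬ Positive v
Positive-asym {u = u} {v} neg (I , uI>0 , before-u) (J , vJ>0 , before-v) with ≺-tri (proj₁ I) (proj₁ J)
... | inj₁ refl = ℚP.<-asym (subst (λ e → 0ℚ ℚ.< v (proj₁ J , e)) (ℕP.≡-irrelevant (proj₂ J) (proj₂ I)) vJ>0)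
                    (subst (ℚ._< 0ℚ) (sym (neg I)) (ℚP.neg-antimono-< uI>0))
... | inj₂ (inj₁ I≺J) = ℚP.<-irrefl (sym (trans (solve 1 (λ x → x := :- (:- x)) refl (u I))
                          (cong ℚ.-_ (trans (sym (neg I)) (before-v I I≺J))))) uI>0
  where open +-*-Solver
... | inj₂ (inj₂ J≺I) = ℚP.<-irrefl (sym (trans (neg J) (cong ℚ.-_ (before-u J J≺I)))) vJ>0

-- Signs of k-roots and their normal forms

mulS : Sgn → Sgn → Sgn
mulS plus t = t
mulS minus plus = minus
mulS minus minus = plus

sgnℤ-mulS : ∀ s t → sgnℤ (mulS s t) ≡ sgnℤ s ℤ.* sgnℤ t
sgnℤ-mulS plus plus = refl
sgnℤ-mulS plus minus = refl
sgnℤ-mulS minus plus = refl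
sgnℤ-mulS minus minus = refl

record Normalised {n} (F : List (Factor n)) : Set where
  constructor normalised
  field
    form : List (Factor n)
    sign : Sgn
    same-length : length form ≡ length F
    same-indices : indices F ↭ indices form
    all-normal : All NormalFactor form
    value : ∀ p → ev p F ≡ sgnℤ sign ℤ.* ev p form

-- The sign of the smaller index is pulled out of each factor: s x_a + t x_b = s (x_a + st x_b),
-- since s squared is 1.
normalise : ∀ {n} (F : List (Factor n)) → Unique (indices F) → Normalised F
normalise [] u = normalised [] plus refl ↭-refl [] (λ p → refl)
normalise {n} ((s , a , t , b) ∷ F) ((a≢b ∷ _) ∷ _ ∷ u) with normalise F u | FinP.<-cmp a b
... | _ | tri≈ _ a≡b _ = contradiction a≡b a≢b
... | normalised G ε l σ nf eq | tri< a<b _ _ = normalised ((plus , a , mulS s t , b) ∷ G) (mulS s ε) (cong suc l)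
  (prep a (prep b σ)) ((refl , a<b) ∷ nf)
  λ p → trans (cong (evF p (s , a , t , b) ℤ.*_) (eq p)) (value s p)
  where
  value : ∀ s p → evF p (s , a , t , b) ℤ.* (sgnℤ ε ℤ.* ev p G) ≡ sgnℤ (mulS s ε) ℤ.* (evF p (plus , a , mulS s t , b) ℤ.* ev p G)
  value s p = trans (square s) (sym (cong₂ (λ x y → x ℤ.* ((1ℤ ℤ.* p a ℤ.+ y ℤ.* p b) ℤ.* ev p G)) (sgnℤ-mulS s ε) (sgnℤ-mulS s t)))
    where
    identity₊ : ∀ T E x y Q → (1ℤ ℤ.* x ℤ.+ T ℤ.* y) ℤ.* (E ℤ.* Q) ≡ (1ℤ ℤ.* E) ℤ.* ((1ℤ ℤ.* x ℤ.+ (1ℤ ℤ.* T) ℤ.* y) ℤ.* Q)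
    identity₊ = ℤR.solve-∀
    identity₋ : ∀ T E x y Q → (ℤ.- 1ℤ ℤ.* x ℤ.+ T ℤ.* y) ℤ.* (E ℤ.* Q) ≡ (ℤ.- 1ℤ ℤ.* E) ℤ.* ((1ℤ ℤ.* x ℤ.+ (ℤ.- 1ℤ ℤ.* T) ℤ.* y) ℤ.* Q)
    identity₋ = ℤR.solve-∀
    -- The solver does not know that a sign squares to 1, so the sign is split into its two cases.
    square : ∀ s → evF p (s , a , t , b) ℤ.* (sgnℤ ε ℤ.* ev p G)
      ≡ (sgnℤ s ℤ.* sgnℤ ε) ℤ.* ((1ℤ ℤ.* p a ℤ.+ (sgnℤ s ℤ.* sgnℤ t) ℤ.* p b) ℤ.* ev p G)
    square plus = identity₊ (sgnℤ t) (sgnℤ ε) (p a) (p b) (ev p G)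
    square minus = identity₋ (sgnℤ t) (sgnℤ ε) (p a) (p b) (ev p G)
... | normalised G ε l σ nf eq | tri> _ _ b<a = normalised ((plus , b , mulS t s , a) ∷ G) (mulS t ε) (cong suc l)
  (swap a b σ) ((refl , b<a) ∷ nf)
  λ p → trans (cong (evF p (s , a , t , b) ℤ.*_) (eq p)) (value t p)
  where
  value : ∀ t p → evF p (s , a , t , b) ℤ.* (sgnℤ ε ℤ.* ev p G) ≡ sgnℤ (mulS t ε) ℤ.* (evF p (plus , b , mulS t s , a) ℤ.* ev p G)
  value t p = trans (square t) (sym (cong₂ (λ x y → x ℤ.* ((1ℤ ℤ.* p b ℤ.+ y ℤ.* p a) ℤ.* ev p G)) (sgnℤ-mulS t ε) (sgnℤ-mulS t s)))
    where
    identity₊ : ∀ T E x y Q → (T ℤ.* y ℤ.+ 1ℤ ℤ.* x) ℤ.* (E ℤ.* Q) ≡ (1ℤ ℤ.* E) ℤ.* ((1ℤ ℤ.* x ℤ.+ (1ℤ ℤ.* T) ℤ.* y) ℤ.* Q)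
    identity₊ = ℤR.solve-∀
    identity₋ : ∀ T E x y Q → (T ℤ.* y ℤ.+ ℤ.- 1ℤ ℤ.* x) ℤ.* (E ℤ.* Q) ≡ (ℤ.- 1ℤ ℤ.* E) ℤ.* ((1ℤ ℤ.* x ℤ.+ (ℤ.- 1ℤ ℤ.* T) ℤ.* y) ℤ.* Q)
    identity₋ = ℤR.solve-∀
    square : ∀ t → evF p (s , a , t , b) ℤ.* (sgnℤ ε ℤ.* ev p G)
      ≡ (sgnℤ t ℤ.* sgnℤ ε) ℤ.* ((1ℤ ℤ.* p b ℤ.+ (sgnℤ t ℤ.* sgnℤ s) ℤ.* p a) ℤ.* ev p G)
    square plus = identity₊ (sgnℤ s) (sgnℤ ε) (p b) (p a) (ev p G)
    square minus = identity₋ (sgnℤ s) (sgnℤ ε) (p b) (p a) (ev p G)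

signed-NF : ∀ {n k} (e : RootExpr n k) → Σ (NF n k) λ f → Σ Sgn λ ε → ∀ I → poly (proj₁ e) I ≡ sgnQ ε ℚ.* polyNF f I
signed-NF {n} {k} (fs , u) with normalise (toList fs) u
... | normalised G ε l σ nf eq with toNF (isNF (trans l (VecP.length-toList fs)) (Unique-↭ σ u) nf)
...   | f , refl = f , ε , λ I → begin
  poly fs I                                        ≡⟨ poly-ev fs u I ⟩
  ι (ev (ind (proj₁ I)) (toList fs))               ≡⟨ cong ι (eq (ind (proj₁ I))) ⟩
  ι (sgnℤ ε ℤ.* ev (ind (proj₁ I)) (facs f))       ≡⟨ ι-* (sgnℤ ε) (ev (ind (proj₁ I)) (facs f)) ⟩
  ι (sgnℤ ε) ℚ.* ι (ev (ind (proj₁ I)) (facs f))   ≡⟨ cong₂ ℚ._*_ (sgnℤ-sgnQ ε) (sym (polyNF-ev f I)) ⟩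
  sgnQ ε ℚ.* polyNF f I ∎
  where open ≡-Reasoning

posRoot-NF : ∀ {n k} {α : V n k} → PosRoot α → Σ (NF n k) λ f → IsNormalFormOf f α
posRoot-NF {α = α} ((e , e≈α) , pos) with signed-NF e
... | f , plus , eq = f , λ I → trans (sym (trans (eq I) (ℚP.*-identityˡ (polyNF f I)))) (e≈α I)
... | f , minus , eq = contradiction pos (Positive-asym negated (positive-NF f))
  where
  open +-*-Solver
  negated : ∀ I → α I ≡ ℚ.- polyNF f I
  negated I = trans (sym (e≈α I)) (trans (eq I) (solve 1 (λ x → (:- con 1ℚ) :* x := :- x) refl (polyNF f I)))

-- Defect-free normal forms and membership in `InB`

comb-scale : ∀ {n} (p : Point n) c Hs → comb p (List.map (c ,_) Hs) ≡ c ℚ.* ι (evs p Hs)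
comb-scale p c [] = sym (ℚP.*-zeroʳ c)
comb-scale p c (H ∷ Hs) = trans (cong (c ℚ.* ι (ev p H) ℚ.+_) (comb-scale p c Hs))
  (trans (sym (ℚP.*-distribˡ-+ c (ι (ev p H)) (ι (evs p Hs)))) (cong (c ℚ.*_) (sym (ι-+ (ev p H) (evs p Hs)))))

ev⇒comb : ∀ {n} {F : List (Factor n)} {Hs} → (∀ p → ev p F ≡ evs p Hs) → ∀ p → ι (ev p F) ≡ comb p (List.map (1ℚ ,_) Hs)
ev⇒comb {F = F} {Hs} eq p = trans (cong ι (eq p)) (sym (trans (comb-scale p 1ℚ Hs) (ℚP.*-identityˡ (ι (evs p Hs)))))

good-parts-label : ∀ {n k} {F G : List (Factor n)} → Good k G → ∀ {Hs} → All (Good k) Hs →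
  (∀ p → ev p F ≡ ev p G) → (∀ p → ev p F ≡ evs p Hs) → All (λ H → lab H ≡ lab G) Hs
good-parts-label {G = G} gG {Hs} good same eq =
  AllP.map⁻ (rigidity gG (AllP.map⁺ good) (AllP.map⁺ (All.map (λ _ → 0<1) good)) (ev⇒comb {F = G} {Hs} (λ p → trans (sym (same p)) (eq p))))

-- `HasDefect` ranges over all normal forms of α, of which f is one. A defective f′ would decompose
-- into at least two good forms; by rigidity all have the label of f, and `sameLabel-parts` allows
-- only one.
good-InB : ∀ {n k} {f : NF n k} {α} → Good k (facs f) → IsNormalFormOf f α → InB α
good-InB {k = k} {f} {α} good f≈α = NF-posRoot {f = f} f≈α , no-defect
  where
  no-defect : ¬ HasDefect α
  no-defect (f′ , f′≈α , d) = ℕP.<-irrefl (sym (proj₁ (sameLabel-parts (facs-IsNF f′) good allGood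
      (good-parts-label {F = facs f′} good allGood (ev-equal {f = f′} {f} f′≈α f≈α) expansion) expansion)))
    (several (Defect⇒Defective d))
    where open Decomposition (decompose (facs-IsNF f′))

InB-good′ : ∀ {n k} {α : V n k} → InB α → (f : NF n k) → IsNormalFormOf f α → Good k (facs f)
InB-good′ (_ , ¬d) f f≈α = facs-IsNF f , λ d → ¬d (f , f≈α , Defective⇒Defect d)

InB-good : ∀ {n k} {α : V n k} → InB α → Σ (NF n k) λ f → IsNormalFormOf f α × Good k (facs f)
InB-good b@(pos , _) with posRoot-NF pos
... | f , f≈α = f , f≈α , InB-good′ b f f≈α

-- Linear independence

toComb : ∀ {n k} (L : List (ℚ × V n k)) → All (λ cv → InB (proj₂ cv)) L → Comb n
toComb [] [] = []
toComb ((c , v) ∷ L) (b ∷ bs) = (c , facs (proj₁ (InB-good b))) ∷ toComb L bs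

toComb-good : ∀ {n k} (L : List (ℚ × V n k)) bs → GoodComb k (toComb L bs)
toComb-good [] [] = []
toComb-good ((c , v) ∷ L) (b ∷ bs) = proj₂ (proj₂ (InB-good b)) ∷ toComb-good L bs

comb-toComb : ∀ {n k} (p : Point n) (L : List (ℚ × V n k)) bs → comb p (toComb L bs) ≡ E p (lincomb L)
comb-toComb {n} {k} p [] [] = sym (E-zero {n} {k} p)
comb-toComb p ((c , v) ∷ L) (b ∷ bs) = sym (trans (E-∷ p c v L)
  (cong₂ (λ x y → c ℚ.* x ℚ.+ y) (E-NF {f = proj₁ (InB-good b)} (proj₁ (proj₂ (InB-good b))) p) (sym (comb-toComb p L bs))))

sameLabel-≈V : ∀ {n k} {f g : NF n k} {α β} → IsNormalFormOf f α → IsNormalFormOf g β →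
  Good k (facs f) → Good k (facs g) → lab (facs f) ≡ lab (facs g) → α ≈V β
sameLabel-≈V {f = f} {g} f≈α g≈β gf gg eq = ≈V-from-ev {f = f} {g} f≈α g≈β (λ p → ev-↭ p (sameLabel-↭ gf gg eq))

labelSum-distinct : ∀ {n k} {v : V n k} (b : InB v) (L : List (ℚ × V n k)) bs → All (λ cv → ¬ (v ≈V proj₂ cv)) L →
  labelSum (lab (facs (proj₁ (InB-good b)))) (toComb L bs) ≡ 0ℚ
labelSum-distinct b [] [] [] = refl
labelSum-distinct {v = v} b ((c , v′) ∷ L) (b′ ∷ bs) (ne ∷ nes) = trans
  (cong₂ (λ x y → c ℚ.* x ℚ.+ y) (𝟙-no {d = lab (facs f′) ≟W lab (facs f)} distinct) (labelSum-distinct b L bs nes))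
  (trans (cong (ℚ._+ 0ℚ) (ℚP.*-zeroʳ c)) (ℚP.+-identityˡ 0ℚ))
  where
  f = proj₁ (InB-good b)
  f′ = proj₁ (InB-good b′)
  distinct : lab (facs f′) ≢ lab (facs f)
  distinct eq = ne (sameLabel-≈V {f = f} {f′} (proj₁ (proj₂ (InB-good b))) (proj₁ (proj₂ (InB-good b′)))
    (proj₂ (proj₂ (InB-good b))) (proj₂ (proj₂ (InB-good b′))) (sym eq))

-- Distinct members have distinct labels, so the total coefficient at the label of the head is just
-- its own coefficient. Once that is 0, the tail vanishes as well.
B-linIndep : ∀ {n k} → LinIndep {n} {k} InB
B-linIndep [] [] [] eq = []
B-linIndep {n} {k} ((c , v) ∷ L) (b ∷ bs) (ne ∷ nes) eq = c≡0 ∷ B-linIndep L bs nes rest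
  where
  open ≡-Reasoning
  K = toComb ((c , v) ∷ L) (b ∷ bs)
  w = lab (facs (proj₁ (InB-good b)))
  vanish : ∀ p → comb p K ≡ 0ℚ
  vanish p = trans (comb-toComb p ((c , v) ∷ L) (b ∷ bs)) (trans (E-cong p eq) (E-zero {n} {k} p))
  c≡0 : c ≡ 0ℚ
  c≡0 = begin
    c                 ≡⟨ trans (ℚP.+-identityʳ _) (ℚP.*-identityʳ c) ⟨
    c ℚ.* 1ℚ ℚ.+ 0ℚ   ≡⟨ cong₂ (λ x y → c ℚ.* x ℚ.+ y) (𝟙-yes {d = w ≟W w} refl) (labelSum-distinct b L bs ne) ⟨
    labelSum w K      ≡⟨ labelSum-zero K (toComb-good ((c , v) ∷ L) (b ∷ bs)) vanish w ⟩
    0ℚ ∎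
  rest : lincomb L ≈V zeroV
  rest I = begin
    lincomb L I                   ≡⟨ ℚP.+-identityˡ _ ⟨
    0ℚ ℚ.+ lincomb L I            ≡⟨ cong (ℚ._+ lincomb L I) (ℚP.*-zeroˡ (v I)) ⟨
    0ℚ ℚ.* v I ℚ.+ lincomb L I    ≡⟨ cong (λ z → z ℚ.* v I ℚ.+ lincomb L I) c≡0 ⟨
    c ℚ.* v I ℚ.+ lincomb L I     ≡⟨ eq I ⟩
    0ℚ ∎

-- Positivity

polys : ∀ {n k} {Hs : List (List (Factor n))} → All (IsNF k) Hs → List (V n k)
polys [] = []
polys (nf ∷ nfs) = polyNF (proj₁ (toNF nf)) ∷ polys nfs

lincomb-polys : ∀ {n k} {Hs : List (List (Factor n))} (nfs : All (IsNF k) Hs) I →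
  lincomb (List.map (1ℚ ,_) (polys nfs)) I ≡ ι (evs (ind (proj₁ I)) Hs)
lincomb-polys [] I = refl
lincomb-polys {Hs = H ∷ Hs} (nf ∷ nfs) I = trans
  (cong₂ ℚ._+_ (trans (ℚP.*-identityˡ _) (trans (polyNF-ev (proj₁ (toNF nf)) I) (cong (ι ∘ ev (ind (proj₁ I))) (proj₂ (toNF nf)))))
    (lincomb-polys nfs I))
  (sym (ι-+ (ev (ind (proj₁ I)) H) (evs (ind (proj₁ I)) Hs)))

polys-InB : ∀ {n k} {Hs : List (List (Factor n))} (good : All (Good k) Hs) → All InB (polys (All.map proj₁ good))
polys-InB [] = []
polys-InB {k = k} ((nf , ¬d) ∷ good) with toNF nf
... | f , refl = good-InB {f = f} (nf , ¬d) (λ _ → refl) ∷ polys-InB good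

-- Each part gets the coefficient 1; larger multiplicities appear as repetitions.
nonnegIntComb : ∀ {n k} (α : V n k) → PosRoot α → NonnegIntCombOfB α
nonnegIntComb α pos with posRoot-NF pos
... | f , f≈α = List.map (1 ,_) (polys nfs) , AllP.map⁺ (polys-InB allGood) , λ I → begin
  lincomb (List.map (λ cv → ℕtoℚ (proj₁ cv) , proj₂ cv) (List.map (1 ,_) (polys nfs))) I
    ≡⟨ cong (λ L → lincomb L I) (ListP.map-∘ (polys nfs)) ⟨
  lincomb (List.map (1ℚ ,_) (polys nfs)) I ≡⟨ lincomb-polys nfs I ⟩
  ι (evs (ind (proj₁ I)) parts)            ≡⟨ cong ι (expansion (ind (proj₁ I))) ⟨
  ι (ev (ind (proj₁ I)) (facs f))          ≡⟨ polyNF-ev f I ⟨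
  polyNF f I                               ≡⟨ f≈α I ⟩
  α I ∎
  where
  open ≡-Reasoning
  open Decomposition (decompose (facs-IsNF f))
  nfs = All.map proj₁ allGood

-- A strictly smaller value at `descending n` is what separates each part from α.
polys-others : ∀ {n k} {f : NF n k} {α} → IsNormalFormOf f α → ∀ {Hs} (nfs : All (IsNF k) Hs) →
  All (λ H → ev (descending n) H ℤ.< ev (descending n) (facs f)) Hs →
  All (λ v → PosRoot v × ¬ (v ≈V α)) (polys nfs)
polys-others f≈α [] [] = []
polys-others {n} {f = f} f≈α (nf ∷ nfs) (lt ∷ lts) with toNF nf
... | h , refl = (NF-posRoot {f = h} (λ _ → refl) ,
  λ h≈α → ℤP.<-irrefl (ev-equal {f = h} {f} h≈α f≈α (descending n)) lt) ∷ polys-others {f = f} f≈α nfs lts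

defect⇒posComb : ∀ {n k} {α : V n k} → HasDefect α → PosCombOfOthers α
defect⇒posComb {n} {α = α} (f , f≈α , d) =
  List.map (1ℚ ,_) (polys allNF) ,
  AllP.map⁺ (All.map (0<1 ,_) (polys-others {f = f} f≈α allNF
    (subst (λ z → All (λ H → ev (descending n) H ℤ.< z) parts) (sym (expansion (descending n)))
      (ev<evs several (All.map ev-descending-pos allNF))))) ,
  λ I → trans (lincomb-polys allNF I) (trans (cong ι (sym (expansion (ind (proj₁ I))))) (trans (sym (polyNF-ev f I)) (f≈α I)))
  where open Resolution (resolve (facs-IsNF f) (Defect⇒Defective d))

record PosExpansion {n k} (L : List (ℚ × V n k)) : Set where
  constructor posExpansion
  field
    combination : Comb n
    allGood : GoodComb k combination
    allPositive : PositiveComb combination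
    value : ∀ p → E p (lincomb L) ≡ comb p combination

expand-head : ∀ {n k} {f : NF n k} {v} {c L Hs K} → IsNormalFormOf f v → (∀ p → ev p (facs f) ≡ evs p Hs) →
  (∀ p → E p (lincomb L) ≡ comb p K) → ∀ p → E p (lincomb ((c , v) ∷ L)) ≡ comb p (List.map (c ,_) Hs ++ K)
expand-head {f = f} {v} {c} {L} {Hs} {K} f≈v expansion eq p = begin
  E p (lincomb ((c , v) ∷ L))                 ≡⟨ E-∷ p c v L ⟩
  c ℚ.* E p v ℚ.+ E p (lincomb L)             ≡⟨ cong₂ (λ x y → c ℚ.* x ℚ.+ y) (trans (E-NF {f = f} f≈v p) (cong ι (expansion p))) (eq p) ⟩
  c ℚ.* ι (evs p Hs) ℚ.+ comb p K             ≡⟨ cong (ℚ._+ comb p K) (comb-scale p c Hs) ⟨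
  comb p (List.map (c ,_) Hs) ℚ.+ comb p K    ≡⟨ comb-++ p (List.map (c ,_) Hs) K ⟨
  comb p (List.map (c ,_) Hs ++ K) ∎
  where open ≡-Reasoning

expandPos : ∀ {n k} (L : List (ℚ × V n k)) → All (λ cv → (0ℚ ℚ.< proj₁ cv) × PosRoot (proj₂ cv)) L → PosExpansion L
expandPos {n} {k} [] [] = posExpansion [] [] [] (λ p → E-zero {n} {k} p)
expandPos ((c , v) ∷ L) ((0<c , pos) ∷ rest) with posRoot-NF pos | expandPos L rest
... | f , f≈v | posExpansion K gK pK eq = posExpansion (List.map (c ,_) parts ++ K)
  (AllP.++⁺ (AllP.map⁺ allGood) gK)
  (AllP.++⁺ (AllP.map⁺ (All.map (λ _ → 0<c) allGood)) pK)
  (expand-head {f = f} {c = c} {L} {parts} {K} f≈v expansion eq)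
  where open Decomposition (decompose (facs-IsNF f))

-- It suffices to look at the head β. With all roots expanded into good forms, rigidity gives each
-- of these the label of α, and `sameLabel-parts` yields β = α. The empty combination is excluded
-- because α is positive at `descending n`.
InB⇒¬posComb : ∀ {n k} {α : V n k} → InB α → ¬ PosCombOfOthers α
InB⇒¬posComb {n} {k} {α} b (L , others , L≈α) = go L others L≈α
  where
  f = proj₁ (InB-good b)
  f≈α = proj₁ (proj₂ (InB-good b))
  good = proj₂ (proj₂ (InB-good b))
  go : ∀ L → All (λ cv → (0ℚ ℚ.< proj₁ cv) × PosRoot (proj₂ cv) × ¬ (proj₂ cv ≈V α)) L → ¬ (lincomb L ≈V α)
  go [] [] L≈α = ℚP.<-irrefl
    (trans (sym (E-zero {n} {k} (descending n))) (trans (E-cong (descending n) L≈α) (E-NF {f = f} f≈α (descending n))))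
    (ι-pos (ev-descending-pos (facs-IsNF f)))
  go ((c , β) ∷ L) ((0<c , pos , β≉α) ∷ others) L≈α with posRoot-NF pos | expandPos L (All.map (λ (a , b , _) → a , b) others)
  ... | h , h≈β | posExpansion K gK pK eq = β≉α (≈V-from-ev {f = h} {f} h≈β f≈α
      (proj₂ (sameLabel-parts (facs-IsNF h) good allGood (AllP.map⁻ (AllP.++⁻ˡ _ labels)) expansion)))
    where
    open Decomposition (decompose (facs-IsNF h))
    labels : All (λ cF → lab (proj₂ cF) ≡ lab (facs f)) (List.map (c ,_) parts ++ K)
    labels = rigidity good (AllP.++⁺ (AllP.map⁺ allGood) gK) (AllP.++⁺ (AllP.map⁺ (All.map (λ _ → 0<c) allGood)) pK) λ p →
      trans (sym (E-NF {f = f} f≈α p)) (trans (sym (E-cong p L≈α)) (expand-head {f = h} {c = c} {L} {parts} {K} h≈β expansion eq p))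

-- Labels are lattice words

length-map-suc : ∀ {n} (xs : List (Fin n)) → length (List.map Fin.suc xs) ≡ length xs
length-map-suc = ListP.length-map Fin.suc

-- Letters are counted by comparing duplicate-free lists of positions; the bound m corresponds to
-- `take m`.
module Positions {A : Set} (_≟_ : (x y : A) → Dec (x ≡ y)) where

  positions : ∀ {n} → A → ℕ → Vec A n → List (Fin n)
  positions x zero w = []
  positions x (suc m) [] = []
  positions x (suc m) (y ∷ w) with x ≟ y
  ... | yes _ = zero ∷ List.map suc (positions x m w)
  ... | no _ = List.map suc (positions x m w)

  ∈-positions⁻ : ∀ {n} x m (w : Vec A n) {j} → j LM.∈ positions x m w → lookup w j ≡ x × toℕ j ℕ.< m
  ∈-positions⁻ x (suc m) (y ∷ w) j∈ with x ≟ y | j∈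
  ... | yes refl | here refl = refl , s≤s z≤n
  ... | yes refl | there j∈′ with LMP.∈-map⁻ suc j∈′
  ...   | i , i∈ , refl with ∈-positions⁻ x m w i∈
  ...     | eq , lt = eq , s≤s lt
  ∈-positions⁻ x (suc m) (y ∷ w) j∈ | no _ | j∈′ with LMP.∈-map⁻ suc j∈′
  ... | i , i∈ , refl with ∈-positions⁻ x m w i∈
  ...   | eq , lt = eq , s≤s lt

  ∈-positions⁺ : ∀ {n} x m (w : Vec A n) {j} → lookup w j ≡ x → toℕ j ℕ.< m → j LM.∈ positions x m w
  ∈-positions⁺ x (suc m) (y ∷ w) {zero} eq lt with x ≟ y
  ... | yes _ = here refl
  ... | no ne = contradiction (sym eq) ne
  ∈-positions⁺ x (suc m) (y ∷ w) {suc j} eq (s≤s lt) with x ≟ y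
  ... | yes _ = there (LMP.∈-map⁺ suc (∈-positions⁺ x m w eq lt))
  ... | no _ = LMP.∈-map⁺ suc (∈-positions⁺ x m w eq lt)

  positions-unique : ∀ {n} x m (w : Vec A n) → Unique (positions x m w)
  positions-unique x zero w = []
  positions-unique x (suc m) [] = []
  positions-unique x (suc m) (y ∷ w) with x ≟ y
  ... | yes _ = AllP.map⁺ (All.tabulate (λ _ ())) ∷ UniqueP.map⁺ FinP.suc-injective (positions-unique x m w)
  ... | no _ = UniqueP.map⁺ FinP.suc-injective (positions-unique x m w)

module BoolPositions = Positions _≟B_
open Positions _≟L_

length-positions : ∀ {n} x m (w : Vec Letter n) → length (positions x m w) ≡ count x (take m (toList w))
length-positions x zero w = refl
length-positions x (suc m) [] = refl
length-positions one (suc m) (one ∷ w) = cong suc (trans (length-map-suc (positions one m w)) (length-positions one m w))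
length-positions one (suc m) (two ∷ w) = trans (length-map-suc (positions one m w)) (length-positions one m w)
length-positions two (suc m) (one ∷ w) = trans (length-map-suc (positions two m w)) (length-positions two m w)
length-positions two (suc m) (two ∷ w) = cong suc (trans (length-map-suc (positions two m w)) (length-positions two m w))

leftEnd rightEnd : ∀ {n} → Factor n → Fin n
leftEnd (_ , a , _ , _) = a
rightEnd (_ , _ , _ , b) = b

lefts-distinct : ∀ {n} {F : List (Factor n)} → Unique (indices F) → AllPairs (λ f g → leftEnd f ≢ leftEnd g) F
lefts-distinct {F = []} u = []
lefts-distinct {F = f ∷ F} ((_ ∷ a∉) ∷ _ ∷ u) = All.tabulate (λ { g∈ refl → All≢⇒∉ a∉ (indices-left g∈) }) ∷ lefts-distinct u

rights-distinct : ∀ {n} {F : List (Factor n)} → Unique (indices F) → AllPairs (λ f g → rightEnd f ≢ rightEnd g) F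
rights-distinct {F = []} u = []
rights-distinct {F = f ∷ F} (_ ∷ b∉ ∷ u) = All.tabulate (λ { g∈ refl → All≢⇒∉ b∉ (indices-right g∈) }) ∷ rights-distinct u

-- An antisymmetric factor (x_i − x_j) contributes a letter 2 at j and a letter 1 at i < j.
lab-lattice : ∀ {n k} {F : List (Factor n)} → IsNF k F → Lattice (toList (lab F))
lab-lattice {n} {k} {F} nf m = begin
  count two (take m (toList w))      ≡⟨ length-positions two m w ⟨
  length (positions two m w)         ≤⟨ subset-length (positions-unique two m w) twos ⟩
  length (List.map rightEnd closers) ≡⟨ trans (ListP.length-map rightEnd closers) (sym (ListP.length-map leftEnd closers)) ⟩
  length (List.map leftEnd closers)  ≤⟨ subset-length (AllPairsP.map⁺ (AllPairsP.filter⁺ closes (lefts-distinct (uniq nf)))) ones ⟩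
  length (positions one m w)         ≡⟨ length-positions one m w ⟩
  count one (take m (toList w)) ∎
  where
  open ℕP.≤-Reasoning
  w = lab F
  closes : (f : Factor n) → Dec (proj₁ (proj₂ (proj₂ f)) ≡ minus × toℕ (rightEnd f) ℕ.< m)
  closes (_ , _ , t , b) = (t ≟S minus) ×-dec (toℕ b ℕ.<? m)
  closers = List.filter closes F
  twos : ∀ {j} → j LM.∈ positions two m w → j LM.∈ List.map rightEnd closers
  twos {j} j∈ with ∈-positions⁻ two m w j∈
  ... | eq , j<m with lab-two nf eq
  ...   | i , f∈ = LMP.∈-map⁺ rightEnd (LMP.∈-filter⁺ closes f∈ (refl , j<m))
  ones : ∀ {i} → i LM.∈ List.map leftEnd closers → i LM.∈ positions one m w
  ones i∈ with LMP.∈-map⁻ leftEnd i∈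
  ... | (s , i , t , j) , f∈ , refl with LMP.∈-filter⁻ closes f∈
  ...   | f∈F , _ , j<m = ∈-positions⁺ one m w (lab-left nf f∈F) (ℕP.<-trans (normal-< nf f∈F) j<m)

count-two-length : ∀ {n} (w : Vec Letter n) → count two (toList w) ≡ length (positions two n w)
count-two-length {n} w = sym (trans (length-positions two n w)
  (cong (count two) (ListP.take-all n (toList w) (ℕP.≤-reflexive (VecP.length-toList w)))))

lab-InΛ : ∀ {n k} {F : List (Factor n)} → IsNF k F → InΛ k (lab F)
lab-InΛ {n} {k} {F} nf = lab-lattice nf , (begin
  count two (toList (lab F))        ≡⟨ count-two-length (lab F) ⟩
  length (positions two n (lab F))  ≤⟨ subset-length (positions-unique two n (lab F)) twos ⟩
  length (List.map rightEnd F)      ≡⟨ trans (ListP.length-map rightEnd F) (len nf) ⟩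
  k ∎)
  where
  open ℕP.≤-Reasoning
  twos : ∀ {j} → j LM.∈ positions two n (lab F) → j LM.∈ List.map rightEnd F
  twos j∈ with lab-two nf (proj₁ (∈-positions⁻ two n (lab F) j∈))
  ... | i , f∈ = LMP.∈-map⁺ rightEnd f∈

LabelSpec : ∀ {n} → List (Factor n) → Vec Letter n → Set
LabelSpec {n} F w = ∀ j → (lookup w j ≡ two → Σ (Fin n) λ i → (plus , i , minus , j) ∈F F)
                        × (Σ (Fin n) (λ i → (plus , i , minus , j) ∈F F) → lookup w j ≡ two)

lookup-ext : ∀ {A : Set} {n} {u w : Vec A n} → (∀ j → lookup u j ≡ lookup w j) → u ≡ w
lookup-ext {u = u} {w} eq = trans (sym (VecP.tabulate∘lookup u)) (trans (VecP.tabulate-cong eq) (VecP.tabulate∘lookup w))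

lab-spec : ∀ {n k} {F : List (Factor n)} → IsNF k F → LabelSpec F (lab F)
lab-spec nf j = lab-two nf , λ { (i , f∈) → lab-closes f∈ }

lab-determined : ∀ {n k} {F : List (Factor n)} {w} → IsNF k F → LabelSpec F w → w ≡ lab F
lab-determined {F = F} {w} nf spec = lookup-ext same
  where
  same : ∀ j → lookup w j ≡ lookup (lab F) j
  same j with lookup w j in eqw | lookup (lab F) j in eql
  ... | one | one = refl
  ... | two | two = refl
  ... | one | two = case trans (sym eqw) (proj₂ (spec j) (lab-two nf eql)) of λ ()
  ... | two | one = case trans (sym eql) (lab-closes (proj₂ (proj₁ (spec j) eqw))) of λ ()

-- Every lattice word is a label: read the word from left to right, keeping the unmatched 1s on
-- a stack; a 2 closes the top of the stack; finally the topmost pairs of the stack are joined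
-- by symmetric factors.

-- h is the height of the stack; the clause with value `Empty` is a 2 that finds nothing to close.
Ballot : ∀ {n} → ℕ → Vec Letter n → Set
Ballot h [] = ⊤
Ballot h (one ∷ w) = Ballot (suc h) w
Ballot zero (two ∷ w) = Empty
Ballot (suc h) (two ∷ w) = Ballot h w

lattice⇒ballot : ∀ {n} h (w : Vec Letter n) →
  (∀ m → count two (take m (toList w)) ≤ h ℕ.+ count one (take m (toList w))) → Ballot h w
lattice⇒ballot h [] _ = tt
lattice⇒ballot h (one ∷ w) lat = lattice⇒ballot (suc h) w
  (λ m → subst (count two (take m (toList w)) ≤_) (ℕP.+-suc h _) (lat (suc m)))
lattice⇒ballot zero (two ∷ w) lat = contradiction (lat 1) λ ()
lattice⇒ballot (suc h) (two ∷ w) lat = lattice⇒ballot h w (λ m → ℕP.≤-pred (lat (suc m)))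

placed : ∀ {n} → List (Factor n) → List (Fin n) → List (Fin n)
placed F st = st ++ indices F

record State {n} (F : List (Factor n)) (st : List (Fin n)) : Set where
  field
    normalF : All NormalFactor F
    distinct : Unique (placed F st)
    descends : AllPairs Fin._>_ st
    notInside : ∀ {s i t j x} → (s , i , t , j) ∈F F → x LM.∈ st → i Fin.< x → ¬ (x Fin.< j)
    plusLast : ∀ {s i j x} → (s , i , plus , j) ∈F F → x LM.∈ st → x Fin.< j
    noCrossing : ∀ {f g} → f ∈F F → g ∈F F → ¬ Crossing f g
    noNested : ∀ {f g} → f ∈F F → g ∈F F → ¬ Nested f g
open State

initial : ∀ {n} → State {n} [] []
initial = record
  { normalF = [] ; distinct = [] ; descends = [] ; notInside = λ () ; plusLast = λ () ; noCrossing = λ () ; noNested = λ () }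

AllMinus : ∀ {n} → List (Factor n) → Set
AllMinus = All (λ { (_ , _ , t , _) → t ≡ minus })

-- The new index lies to the right of everything placed, so `plusLast` can hold only while there are
-- no symmetric factors. They are therefore formed after the whole word has been read.
push : ∀ {n} {F : List (Factor n)} {st x} → State F st → AllMinus F → (∀ {y} → y LM.∈ placed F st → y Fin.< x) → State F (x ∷ st)
push {F = F} {st} {x} S minuses below = record
  { normalF = normalF S
  ; distinct = All.tabulate (λ { y∈ refl → FinP.<-irrefl refl (below y∈) }) ∷ distinct S
  ; descends = All.tabulate (λ y∈ → below (LMP.∈-++⁺ˡ y∈)) ∷ descends S
  ; notInside = λ { f∈ (here refl) _ x<j → ℕP.<-asym x<j (below (LMP.∈-++⁺ʳ st (indices-right f∈)))
                  ; f∈ (there y∈) → notInside S f∈ y∈ }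
  ; plusLast = λ f∈ → case All.lookup minuses f∈ of λ ()
  ; noCrossing = noCrossing S
  ; noNested = noNested S
  }

placed-join : ∀ {n} (F : List (Factor n)) st x y t → placed F (x ∷ y ∷ st) ↭ placed ((plus , y , t , x) ∷ F) st
placed-join F st x y t = ↭-trans (swap x y ↭-refl) (PermP.shifts (y ∷ x ∷ []) st)

-- One step for two uses: with `minus`, right after pushing the position of a 2, it matches that 2;
-- with `plus` it forms the symmetric factors at the end.
join : ∀ {n} {F : List (Factor n)} {st x y} t → State F (x ∷ y ∷ st) → State ((plus , y , t , x) ∷ F) st
join {F = F} {st} {x} {y} t S with descends S
... | (y<x ∷ _) ∷ (below-y ∷ desc) = record
  { normalF = (refl , y<x) ∷ normalF S
  ; distinct = Unique-↭ (placed-join F st x y t) (distinct S)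
  ; descends = desc
  ; notInside = λ { (here refl) z∈ y<z _ → ℕP.<-asym y<z (All.lookup below-y z∈)
                  ; (there f∈) z∈ → notInside S f∈ (there (there z∈)) }
  ; plusLast = λ { (here refl) z∈ → FinP.<-trans (All.lookup below-y z∈) y<x
                 ; (there f∈) z∈ → plusLast S f∈ (there (there z∈)) }
  ; noCrossing = λ { (here refl) (here refl) (i<i , _) → FinP.<-irrefl refl i<i
                   ; (here refl) (there g∈) (_ , j<x , x<s) → notInside S g∈ (here refl) j<x x<s
                   ; (there f∈) (here refl) (i<y , y<r , _) → notInside S f∈ (there (here refl)) i<y y<r
                   ; (there f∈) (there g∈) → noCrossing S f∈ g∈ }
  ; noNested = λ { (here refl) (here refl) (_ , i<i , _) → FinP.<-irrefl refl i<i
                 ; (here refl) (there g∈) (refl , _ , _ , r<x) → ℕP.<-asym r<x (plusLast S g∈ (here refl))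
                 ; (there f∈) (here refl) (_ , i<y , y<x , x<s) → notInside S f∈ (there (here refl)) i<y (FinP.<-trans y<x x<s)
                 ; (there f∈) (there g∈) → noNested S f∈ g∈ }
  }

record Matching {n} (w : Vec Letter n) : Set where
  field
    F : List (Factor n)
    st : List (Fin n)
    state : State F st
    minuses : AllMinus F
    covers : ∀ x → x LM.∈ placed F st
    spec : LabelSpec F w

-- e embeds the positions of the unread suffix of w.
match : ∀ {n l} {w : Vec Letter n} (ws : Vec Letter l) (e : Fin l → Fin n) {F st} →
  (∀ {i j} → i Fin.< j → e i Fin.< e j) →
  (∀ i → lookup w (e i) ≡ lookup ws i) →
  State F st → AllMinus F →
  (∀ {y} → y LM.∈ placed F st → ∀ i → y Fin.< e i) →
  (∀ x → x LM.∈ placed F st ⊎ ∃ λ i → x ≡ e i) →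
  (∀ {i j} → (plus , i , minus , j) ∈F F → lookup w j ≡ two) →
  (∀ {y} → y LM.∈ placed F st → lookup w y ≡ two → ∃ λ i → (plus , i , minus , y) ∈F F) →
  Ballot (length st) ws → Matching w
match [] e {F} {st} mono eq S minuses below cover sound complete ballot = record
  { F = F ; st = st ; state = S ; minuses = minuses ; covers = λ x → [ id , (λ { (() , _) }) ]′ (cover x)
  ; spec = λ j → complete ([ id , (λ { (() , _) }) ]′ (cover j)) , λ { (i , f∈) → sound f∈ } }
match {w = w} (one ∷ ws) e {F} {st} mono eq S minuses below cover sound complete ballot =
  match ws (e ∘ suc) (mono ∘ s≤s) (eq ∘ suc) (push S minuses (λ y∈ → below y∈ zero)) minuses
    (λ { (here refl) i → mono (s≤s z≤n) ; (there y∈) i → below y∈ (suc i) })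
    cover′ sound
    (λ { (here refl) two≡ → case trans (sym two≡) (eq zero) of λ () ; (there y∈) → complete y∈ }) ballot
  where
  cover′ : ∀ x → x LM.∈ placed F (e zero ∷ st) ⊎ ∃ λ i → x ≡ e (suc i)
  cover′ x with cover x
  ... | inj₁ x∈ = inj₁ (there x∈)
  ... | inj₂ (zero , refl) = inj₁ (here refl)
  ... | inj₂ (suc i , refl) = inj₂ (i , refl)
match {w = w} (two ∷ ws) e {F} {y ∷ st} mono eq S minuses below cover sound complete ballot =
  match ws (e ∘ suc) (mono ∘ s≤s) (eq ∘ suc) (join minus (push S minuses (λ y∈ → below y∈ zero))) (refl ∷ minuses)
    (λ y∈ → below′ (PermP.∈-resp-↭ (↭-sym σ) y∈)) cover′
    (λ { (here refl) → eq zero ; (there f∈) → sound f∈ })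
    (λ y∈ → complete′ (PermP.∈-resp-↭ (↭-sym σ) y∈)) ballot
  where
  F′ = (plus , y , minus , e zero) ∷ F
  σ = placed-join F st (e zero) y minus
  below′ : ∀ {z} → z LM.∈ placed F (e zero ∷ y ∷ st) → ∀ i → z Fin.< e (suc i)
  below′ (here refl) i = mono (s≤s z≤n)
  below′ (there z∈) i = below z∈ (suc i)
  cover′ : ∀ x → x LM.∈ placed F′ st ⊎ ∃ λ i → x ≡ e (suc i)
  cover′ x with cover x
  ... | inj₁ x∈ = inj₁ (PermP.∈-resp-↭ σ (there x∈))
  ... | inj₂ (zero , refl) = inj₁ (PermP.∈-resp-↭ σ (here refl))
  ... | inj₂ (suc i , refl) = inj₂ (i , refl)
  complete′ : ∀ {z} → z LM.∈ placed F (e zero ∷ y ∷ st) → lookup w z ≡ two → ∃ λ i → (plus , i , minus , z) ∈F F′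
  complete′ (here refl) _ = y , here refl
  complete′ (there z∈) z₂ with complete z∈ z₂
  ... | i , f∈ = i , there f∈

matching : ∀ {n} {w : Vec Letter n} → Lattice (toList w) → Matching w
matching {w = w} lat = match w id id (λ _ → refl) initial [] (λ ()) (λ x → inj₂ (x , refl)) (λ ()) (λ ()) (lattice⇒ballot 0 w lat)

length-indices : ∀ {n} (F : List (Factor n)) → length (indices F) ≡ 2 * length F
length-indices [] = refl
length-indices (f ∷ F) = trans (cong (2 ℕ.+_) (length-indices F)) (sym (ℕP.*-suc 2 (length F)))

placed-length : ∀ {n} {w : Vec Letter n} (M : Matching w) → length (Matching.st M) ℕ.+ 2 * length (Matching.F M) ≡ n
placed-length {n} M = begin
  length st ℕ.+ 2 * length F             ≡⟨ cong (length st ℕ.+_) (length-indices F) ⟨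
  length st ℕ.+ length (indices F)       ≡⟨ ListP.length-++ st ⟨
  length (placed F st)                   ≡⟨ PermP.↭-length all ⟩
  length (List.allFin n)                 ≡⟨ ListP.length-tabulate id ⟩
  n ∎
  where
  open ≡-Reasoning
  open Matching M
  all : placed F st ↭ List.allFin n
  all = subset-↭ (distinct state) (λ {x} _ → LMP.∈-allFin x)
    (ℕP.≤-antisym (subset-length (distinct state) (λ {x} _ → LMP.∈-allFin x))
                  (subset-length (UniqueP.allFin⁺ n) (λ {x} _ → covers x)))

record Joined {n} (c : ℕ) (w : Vec Letter n) (F : List (Factor n)) (st : List (Fin n)) : Set where
  field
    G : List (Factor n)
    st′ : List (Fin n)
    state′ : State G st′
    covers′ : ∀ x → x LM.∈ placed G st′
    spec′ : LabelSpec G w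
    length′ : length G ≡ c ℕ.+ length F

joinPlus : ∀ {n} c {w : Vec Letter n} {F st} → 2 * c ≤ length st → State F st → (∀ x → x LM.∈ placed F st) → LabelSpec F w → Joined c w F st
joinPlus zero _ S cover spec = record { G = _ ; st′ = _ ; state′ = S ; covers′ = cover ; spec′ = spec ; length′ = refl }
joinPlus (suc c) {w} {F} {st} le S cover spec with st | subst (_≤ length st) (ℕP.*-suc 2 c) le
... | x ∷ y ∷ st₁ | s≤s (s≤s le′) = record
  { G = G ; st′ = st′ ; state′ = state′ ; covers′ = covers′ ; spec′ = spec′
  ; length′ = trans length′ (ℕP.+-suc c (length F)) }
  where
  cover₁ : ∀ z → z LM.∈ placed ((plus , y , plus , x) ∷ F) st₁
  cover₁ z = PermP.∈-resp-↭ (placed-join F st₁ x y plus) (cover z)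
  spec₁ : LabelSpec ((plus , y , plus , x) ∷ F) w
  spec₁ j = (λ j₂ → proj₁ (proj₁ (spec j) j₂) , there (proj₂ (proj₁ (spec j) j₂))) ,
            λ { (i , there f∈) → proj₂ (spec j) (i , f∈) }
  open Joined (joinPlus c {w} le′ (join plus S) cover₁ spec₁)

joined-good : ∀ {n} {F : List (Factor n)} {st} → State F st → (∀ x → x LM.∈ placed F st) → ¬ Defective F
joined-good S cover (crossing d) = let _ , f∈ , d′ = LM.find d ; _ , g∈ , c = LM.find d′ in noCrossing S f∈ g∈ c
joined-good S cover (nested d) = let _ , f∈ , d′ = LM.find d ; _ , g∈ , c = LM.find d′ in noNested S f∈ g∈ c
joined-good {st = st} S cover (gapInside d) with LM.find d
... | (s , i , t , r) , f∈ , (j , i<j , j<r , unused) with LMP.∈-++⁻ st (cover j)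
...   | inj₁ j∈ = notInside S f∈ j∈ i<j j<r
...   | inj₂ j∈ = unused j∈
joined-good {st = st} S cover (gapAfter d) with LM.find d
... | (s , i , t , j) , f∈ , (refl , r , j<r , unused) with LMP.∈-++⁻ st (cover r)
...   | inj₁ r∈ = ℕP.<-asym j<r (plusLast S f∈ r∈)
...   | inj₂ r∈ = unused r∈

-- The matching has one factor for each 2, hence at most k of them, and leaves n - 2 `length F`
-- indices on the stack. As 2k ≤ n, these suffice for the k - `length F` symmetric factors still
-- missing.
exists-good : ∀ {n k} (w : Vec Letter n) → 2 * k ≤ n → InΛ k w → ∃ λ F → Good k F × LabelSpec F w
exists-good {n} {k} w 2k≤n (lat , twos≤k) = G , (isNF length-G (UniqueP-++ʳ st′ (distinct state′)) (normalF state′) , joined-good state′ covers′) , spec′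
  where
  M = matching {w = w} lat
  open Matching M
  UniqueP-++ʳ : ∀ {A : Set} (xs : List A) {ys} → Unique (xs ++ ys) → Unique ys
  UniqueP-++ʳ [] u = u
  UniqueP-++ʳ (x ∷ xs) (_ ∷ u) = UniqueP-++ʳ xs u
  open ℕP.≤-Reasoning
  F≤k : length F ≤ k
  F≤k = begin
    length F                     ≡⟨ ListP.length-map rightEnd F ⟨
    length (List.map rightEnd F) ≤⟨ subset-length (AllPairsP.map⁺ (rights-distinct (UniqueP-++ʳ st (distinct state)))) closed ⟩
    length (positions two n w)   ≡⟨ count-two-length w ⟨
    count two (toList w)         ≤⟨ twos≤k ⟩
    k ∎
    where
    closed : ∀ {j} → j LM.∈ List.map rightEnd F → j LM.∈ positions two n w
    closed j∈ with LMP.∈-map⁻ rightEnd j∈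
    ... | (s , i , t , j) , f∈ , refl with All.lookup minuses f∈ | All.lookup (normalF state) f∈
    ...   | refl | refl , _ = ∈-positions⁺ two n w (proj₂ (spec j) (i , f∈)) (FinP.toℕ<n j)
  enough : 2 * (k ℕ.∸ length F) ≤ length st
  enough = begin
    2 * (k ℕ.∸ length F)          ≡⟨ ℕP.*-distribˡ-∸ 2 k (length F) ⟩
    2 * k ℕ.∸ 2 * length F        ≤⟨ ℕP.∸-monoˡ-≤ (2 * length F) 2k≤n ⟩
    n ℕ.∸ 2 * length F            ≡⟨ cong (ℕ._∸ 2 * length F) (placed-length M) ⟨
    length st ℕ.+ 2 * length F ℕ.∸ 2 * length F ≡⟨ ℕP.m+n∸n≡m (length st) (2 * length F) ⟩
    length st ∎
  open Joined (joinPlus (k ℕ.∸ length F) {w} enough state covers spec)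
  length-G : length G ≡ k
  length-G = trans length′ (ℕP.m∸n+n≡m F≤k)

-- Spanning

InSpan : ∀ {n k} → V n k → Set
InSpan {n} {k} v = Σ (List (ℚ × V n k)) λ L → All (λ cv → InB (proj₂ cv)) L × lincomb L ≈V v

span-cong : ∀ {n k} {u v : V n k} → u ≈V v → InSpan u → InSpan v
span-cong u≈v (L , bs , eq) = L , bs , λ I → trans (eq I) (u≈v I)

span-zero : ∀ {n k} → InSpan (zeroV {n} {k})
span-zero = [] , [] , λ _ → refl

lincomb-++ : ∀ {n k} (L M : List (ℚ × V n k)) I → lincomb (L ++ M) I ≡ lincomb L I ℚ.+ lincomb M I
lincomb-++ [] M I = sym (ℚP.+-identityˡ _)
lincomb-++ ((c , v) ∷ L) M I = trans (cong (c ℚ.* v I ℚ.+_) (lincomb-++ L M I))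
  (sym (ℚP.+-assoc (c ℚ.* v I) (lincomb L I) (lincomb M I)))

span-+ : ∀ {n k} {u v : V n k} → InSpan u → InSpan v → InSpan (λ I → u I ℚ.+ v I)
span-+ (L , bs , eq) (M , bs′ , eq′) = L ++ M , AllP.++⁺ bs bs′ , λ I → trans (lincomb-++ L M I) (cong₂ ℚ._+_ (eq I) (eq′ I))

scaleBy : ∀ {n k} → ℚ → List (ℚ × V n k) → List (ℚ × V n k)
scaleBy c = List.map (λ { (d , v) → c ℚ.* d , v })

lincomb-scaleBy : ∀ {n k} c (L : List (ℚ × V n k)) I → lincomb (scaleBy c L) I ≡ c ℚ.* lincomb L I
lincomb-scaleBy c [] I = sym (ℚP.*-zeroʳ c)
lincomb-scaleBy c ((d , v) ∷ L) I = trans (cong (c ℚ.* d ℚ.* v I ℚ.+_) (lincomb-scaleBy c L I))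
  (solve 4 (λ c d x r → c :* d :* x :+ c :* r := c :* (d :* x :+ r)) refl c d (v I) (lincomb L I))
  where open +-*-Solver

span-* : ∀ {n k} c {v : V n k} → InSpan v → InSpan (λ I → c ℚ.* v I)
span-* c (L , bs , eq) = scaleBy c L , AllP.map⁺ bs , λ I → trans (lincomb-scaleBy c L I) (cong (c ℚ.*_) (eq I))

span-sum : ∀ {n k} m (G : Subset m → V n k) → (∀ S → InSpan (G S)) → InSpan (λ I → SubsetSum.sumV m (λ S → G S I))
span-sum zero G spans = spans []
span-sum (suc m) G spans = span-+ (span-sum m (G ∘ (true ∷_)) (spans ∘ (true ∷_))) (span-sum m (G ∘ (false ∷_)) (spans ∘ (false ∷_)))

span-root : ∀ {n k} (e : RootExpr n k) → InSpan (poly (proj₁ e))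
span-root {n} {k} e with signed-NF e
... | f , ε , eq with nonnegIntComb (polyNF f) (NF-posRoot {f = f} (λ _ → refl))
...   | L , bs , L≈f = span-cong (λ I → sym (eq I)) (span-* (sgnQ ε) {polyNF f} (List.map (λ cv → ℕtoℚ (proj₁ cv) , proj₂ cv) L , AllP.map⁺ bs , L≈f))

lefts : ∀ {n} → Point n → List (Factor n) → ℤ
lefts p [] = 1ℤ
lefts p ((_ , a , _ , _) ∷ P) = p a ℤ.* lefts p P

-- x_a is the half-sum of x_a + x_b and x_a − x_b; only the index pairs of P matter.
span-lefts : ∀ {n k} (P F : List (Factor n)) → Unique (indices F ++ indices P) → length F ℕ.+ length P ≡ k →
  InSpan {n} {k} (λ I → ι (ev (ind (proj₁ I)) F ℤ.* lefts (ind (proj₁ I)) P))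
span-lefts {n} [] F u refl = subst (λ k → InSpan {n} {k} (λ I → ι (ev (ind (proj₁ I)) F ℤ.* 1ℤ))) (sym (ℕP.+-identityʳ (length F)))
  (span-cong (λ I → trans (poly-ev fs uF I) (cong ι (trans (cong (ev (ind (proj₁ I))) eq) (sym (ℤP.*-identityʳ _))))) (span-root (fs , uF)))
  where
  fs = Vec.fromList F
  eq = VecP.toList∘fromList F
  uF : Unique (indices (toList fs))
  uF = subst (Unique ∘ indices) (sym eq) (subst Unique (ListP.++-identityʳ (indices F)) u)
span-lefts {n} {k} ((s , a , t , b) ∷ P) F u l = span-cong {u = λ I → ½ ℚ.* term plus I ℚ.+ ½ ℚ.* term minus I} halves (span-+ (half plus) (half minus))
  where
  term : Sgn → V n k
  term ε I = ι (ev (ind (proj₁ I)) ((plus , a , ε , b) ∷ F) ℤ.* lefts (ind (proj₁ I)) P)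
  half : ∀ ε → InSpan (λ I → ½ ℚ.* term ε I)
  half ε = span-* ½ {term ε} (span-lefts P ((plus , a , ε , b) ∷ F) (Unique-↭ (PermP.shifts (indices F) (a ∷ b ∷ [])) u)
    (trans (sym (ℕP.+-suc (length F) (length P))) l))
  doubled : ∀ x y Q M → ((1ℤ ℤ.* x ℤ.+ 1ℤ ℤ.* y) ℤ.* Q) ℤ.* M ℤ.+ ((1ℤ ℤ.* x ℤ.+ ℤ.- 1ℤ ℤ.* y) ℤ.* Q) ℤ.* M
    ≡ (1ℤ ℤ.+ 1ℤ) ℤ.* (Q ℤ.* (x ℤ.* M))
  doubled = ℤR.solve-∀
  halves : ∀ I → ½ ℚ.* term plus I ℚ.+ ½ ℚ.* term minus I ≡ ι (ev (ind (proj₁ I)) F ℤ.* lefts (ind (proj₁ I)) ((s , a , t , b) ∷ P))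
  halves I = begin
    ½ ℚ.* term plus I ℚ.+ ½ ℚ.* term minus I   ≡⟨ ℚP.*-distribˡ-+ ½ (term plus I) (term minus I) ⟨
    ½ ℚ.* (term plus I ℚ.+ term minus I)       ≡⟨ cong (½ ℚ.*_) (ι-+ (X plus) (X minus)) ⟨
    ½ ℚ.* ι (X plus ℤ.+ X minus)               ≡⟨ cong (λ z → ½ ℚ.* ι z) (doubled (p a) (p b) (ev p F) (lefts p P)) ⟩
    ½ ℚ.* ι ((1ℤ ℤ.+ 1ℤ) ℤ.* Y)                ≡⟨ cong (½ ℚ.*_) (ι-* (1ℤ ℤ.+ 1ℤ) Y) ⟩
    ½ ℚ.* (ι (1ℤ ℤ.+ 1ℤ) ℚ.* ι Y)              ≡⟨ ℚP.*-assoc ½ (ι (1ℤ ℤ.+ 1ℤ)) (ι Y) ⟨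
    1ℚ ℚ.* ι Y                                 ≡⟨ ℚP.*-identityˡ (ι Y) ⟩
    ι Y ∎
    where
    open ≡-Reasoning
    p = ind (proj₁ I)
    X : Sgn → ℤ
    X ε = ev p ((plus , a , ε , b) ∷ F) ℤ.* lefts p P
    Y = ev p F ℤ.* lefts p ((s , a , t , b) ∷ P)

open BoolPositions using () renaming (positions to positionsB)

length-members : ∀ {n} (I : Subset n) → length (positionsB true n I) ≡ ∣ I ∣
length-members [] = refl
length-members {suc n} (true ∷ I) = cong suc (trans (length-map-suc (positionsB true n I)) (length-members I))
length-members {suc n} (false ∷ I) = trans (length-map-suc (positionsB true n I)) (length-members I)

length-both : ∀ {n} (I : Subset n) → length (positionsB true n I) ℕ.+ length (positionsB false n I) ≡ n
length-both [] = refl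
length-both {suc n} (true ∷ I) = cong suc (trans (cong₂ ℕ._+_ (length-map-suc (positionsB true n I)) (length-map-suc (positionsB false n I))) (length-both I))
length-both {suc n} (false ∷ I) = trans (cong₂ (λ x y → x ℕ.+ suc y) (length-map-suc (positionsB true n I)) (length-map-suc (positionsB false n I)))
  (trans (ℕP.+-suc (length (positionsB true n I)) (length (positionsB false n I))) (cong suc (length-both I)))

pairUp : ∀ {n} → List (Fin n) → List (Fin n) → List (Factor n)
pairUp (x ∷ xs) (y ∷ ys) = (plus , x , plus , y) ∷ pairUp xs ys
pairUp _ _ = []

length-pairUp : ∀ {n} (xs ys : List (Fin n)) → length xs ≤ length ys → length (pairUp xs ys) ≡ length xs
length-pairUp [] ys le = refl
length-pairUp (x ∷ xs) (y ∷ ys) (s≤s le) = cong suc (length-pairUp xs ys le)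

∈-pairUp : ∀ {n} (xs ys : List (Fin n)) {z} → z LM.∈ indices (pairUp xs ys) → z LM.∈ xs ⊎ z LM.∈ ys
∈-pairUp (x ∷ xs) (y ∷ ys) (here refl) = inj₁ (here refl)
∈-pairUp (x ∷ xs) (y ∷ ys) (there (here refl)) = inj₂ (here refl)
∈-pairUp (x ∷ xs) (y ∷ ys) (there (there z∈)) = [ inj₁ ∘ there , inj₂ ∘ there ]′ (∈-pairUp xs ys z∈)

pairUp-unique : ∀ {n} (xs ys : List (Fin n)) → Unique xs → Unique ys → (∀ {z} → z LM.∈ xs → ¬ (z LM.∈ ys)) → Unique (indices (pairUp xs ys))
pairUp-unique [] ys _ _ _ = []
pairUp-unique (x ∷ xs) [] _ _ _ = []
pairUp-unique (x ∷ xs) (y ∷ ys) (x∉ ∷ uxs) (y∉ ∷ uys) disjoint =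
  ((λ { refl → disjoint (here refl) (here refl) })
    ∷ ∉⇒All≢ λ x∈ → [ All≢⇒∉ x∉ , (λ x∈ys → disjoint (here refl) (there x∈ys)) ]′ (∈-pairUp xs ys x∈))
  ∷ ∉⇒All≢ (λ y∈ → [ (λ y∈xs → disjoint (there y∈xs) (here refl)) , All≢⇒∉ y∉ ]′ (∈-pairUp xs ys y∈))
  ∷ pairUp-unique xs ys uxs uys (λ z∈ z∈′ → disjoint (there z∈) (there z∈′))

productAt : ∀ {n} → Point n → List (Fin n) → ℤ
productAt p [] = 1ℤ
productAt p (x ∷ xs) = p x ℤ.* productAt p xs

lefts-pairUp : ∀ {n} (p : Point n) xs ys → length xs ≤ length ys → lefts p (pairUp xs ys) ≡ productAt p xs
lefts-pairUp p [] ys le = refl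
lefts-pairUp p (x ∷ xs) (y ∷ ys) (s≤s le) = cong (p x ℤ.*_) (lefts-pairUp p xs ys le)

productAt-suc : ∀ {n} (p : Point (suc n)) xs → productAt p (List.map suc xs) ≡ productAt (p ∘ suc) xs
productAt-suc p [] = refl
productAt-suc p (x ∷ xs) = cong (p (suc x) ℤ.*_) (productAt-suc p xs)

productAt-members : ∀ {n} (p : Point n) (I : Subset n) → productAt p (positionsB true n I) ≡ mon p I
productAt-members p [] = refl
productAt-members {suc n} p (true ∷ I) = cong (p zero ℤ.*_) (trans (productAt-suc p (positionsB true n I)) (productAt-members (p ∘ suc) I))
productAt-members {suc n} p (false ∷ I) = trans (productAt-suc p (positionsB true n I)) (productAt-members (p ∘ suc) I)

-- Each index of S gets a partner outside S, of which there are n - k ≥ k; the partners cancel in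
-- the half-sums.
span-monomial : ∀ {n k} → 2 * k ≤ n → (S : Subset n) → ∣ S ∣ ≡ k → InSpan {n} {k} (λ I → ι (mon (ind (proj₁ I)) S))
span-monomial {n} {k} 2k≤n S size = span-cong
  (λ I → cong ι (trans (ℤP.*-identityˡ (lefts (ind (proj₁ I)) P)) (trans (lefts-pairUp (ind (proj₁ I)) ins outs ins≤outs) (productAt-members (ind (proj₁ I)) S))))
  (span-lefts P [] (pairUp-unique ins outs (BoolPositions.positions-unique true n S) (BoolPositions.positions-unique false n S) disjoint)
    (trans (length-pairUp ins outs ins≤outs) (trans (length-members S) size)))
  where
  ins = positionsB true n S
  outs = positionsB false n S
  P = pairUp ins outs
  disjoint : ∀ {z} → z LM.∈ ins → ¬ (z LM.∈ outs)
  disjoint z∈ z∈′ = case trans (sym (proj₁ (BoolPositions.∈-positions⁻ true n S z∈))) (proj₁ (BoolPositions.∈-positions⁻ false n S z∈′)) of λ ()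
  ins≤outs : length ins ≤ length outs
  ins≤outs = subst (_≤ length outs) (sym (trans (length-members S) size)) (ℕP.+-cancelˡ-≤ k k (length outs) (begin
    k ℕ.+ k                     ≡⟨ cong (k ℕ.+_) (ℕP.+-identityʳ k) ⟨
    2 * k                       ≤⟨ 2k≤n ⟩
    n                           ≡⟨ length-both S ⟨
    length ins ℕ.+ length outs  ≡⟨ cong (ℕ._+ length outs) (trans (length-members S) size) ⟩
    k ℕ.+ length outs ∎))
    where open ℕP.≤-Reasoning

-- This is the expansion of v in monomials: at the indicator of I the sum defining `E` collapses to
-- the coefficient of x_I.
E-ind : ∀ {n k} (v : V n k) I → E (ind (proj₁ I)) v ≡ v I
E-ind {n} {k} v (I , size) = trans (SubsetSum.sumV-single n (λ S → ext v S ℚ.* ι (mon (ind I) S)) I off)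
  (trans (cong₂ (λ x y → x ℚ.* ι y) (ext-KSet v I size) (mon-ind-self I)) (ℚP.*-identityʳ (v (I , size))))
  where
  off : ∀ S → S ≢ I → ext v S ℚ.* ι (mon (ind I) S) ≡ 0ℚ
  off S S≢I with ∣ S ∣ ℕ.≟ k
  ... | no _ = ℚP.*-zeroˡ (ι (mon (ind I) S))
  ... | yes size′ with mon-ind-other I S (ℕP.≤-reflexive (trans size (sym size′)))
  ...   | inj₁ eq = contradiction eq S≢I
  ...   | inj₂ eq = trans (cong (λ z → v (S , size′) ℚ.* ι z) eq) (ℚP.*-zeroʳ (v (S , size′)))

B-spans : ∀ {n k} → 2 * k ≤ n → Spans {n} {k} InB
B-spans {n} {k} 2k≤n v = span-cong (E-ind v) (span-sum n (λ S I → ext v S ℚ.* ι (mon (ind (proj₁ I)) S)) summand)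
  where
  summand : ∀ S → InSpan {n} {k} (λ I → ext v S ℚ.* ι (mon (ind (proj₁ I)) S))
  summand S with ∣ S ∣ ℕ.≟ k
  ... | yes size = span-* (v (S , size)) (span-monomial 2k≤n S size)
  ... | no _ = span-cong (λ I → sym (ℚP.*-zeroˡ (ι (mon (ind (proj₁ I)) S)))) span-zero

-- The label bijection and the assembly of the four statements

labelBijection : ∀ n k → 2 * k ≤ n → LabelBijection n k
labelBijection n k 2k≤n = labelled , well-defined , injective , surjective
  where
  labelled : ∀ (α : V n k) → InB α → Σ (Vec Letter n) λ w → HasLabel α w × InΛ k w
  labelled α b with InB-good b
  ... | f , f≈α , (nf , _) = lab (facs f) , (f , f≈α , lab-spec nf) , lab-InΛ nf
  well-defined : ∀ (α : V n k) w w′ → InB α → HasLabel α w → HasLabel α w′ → w ≡ w′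
  -- Both normal forms of α are defect-free, so rigidity applies to one of them and the one-term
  -- combination given by the other.
  well-defined α w w′ b (f , f≈α , spec) (g , g≈α , spec′) = trans (lab-determined {w = w} (facs-IsNF f) spec)
    (trans (sym (All.head (good-parts-label {F = facs f} (InB-good′ b f f≈α) (InB-good′ b g g≈α ∷ [])
       (λ p → refl) (λ p → trans (ev-equal {f = f} {g} f≈α g≈α p) (sym (ℤP.+-identityʳ (ev p (facs g))))))))
     (sym (lab-determined {w = w′} (facs-IsNF g) spec′)))
  injective : ∀ (α β : V n k) w → InB α → InB β → HasLabel α w → HasLabel β w → α ≈V β
  injective α β w bα bβ (f , f≈α , spec) (g , g≈β , spec′) = sameLabel-≈V {f = f} {g} f≈α g≈β (InB-good′ bα f f≈α) (InB-good′ bβ g g≈β)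
    (trans (sym (lab-determined {w = w} (facs-IsNF f) spec)) (lab-determined {w = w} (facs-IsNF g) spec′))
  surjective : ∀ (w : Vec Letter n) → InΛ k w → Σ (V n k) λ α → InB α × HasLabel α w
  surjective w w∈Λ with exists-good w 2k≤n w∈Λ
  ... | F , good , spec with toNF (proj₁ good)
  ...   | f , refl = polyNF f , good-InB {f = f} good (λ _ → refl) , f , (λ _ → refl) , spec

theorem3p10 : ∀ (n k : ℕ) → 2 ≤ n → 2 * k ≤ n →
    LabelBijection n k
    × IsBasis {n} {k} InB
    × (∀ (α : V n k) → PosRoot α → NonnegIntCombOfB α)
    × (∀ (α : V n k) → PosRoot α →
    (InB α → ¬ PosCombOfOthers α) × (¬ PosCombOfOthers α → InB α))
theorem3p10 n k _ 2k≤n =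
  labelBijection n k 2k≤n ,
  (B-spans 2k≤n , B-linIndep) ,
  nonnegIntComb ,
  λ α pos → InB⇒¬posComb , λ ¬comb → pos , λ defect → ¬comb (defect⇒posComb defect)
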